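{- For every integer $n\geq 1$, the following polynomial identities hold: $$R_{n+1}(x)=\sum_{k=0}^n\binom{n}{k}T_k(x)T_{n-k}(x),$$ $$R_{n+2}(x)=2\sum_{k=0}^n\binom{n}{k}T_k(x)T_{n-k+1}(x),$$ $$R_{n+2}(x)=2x\sum_{k=0}^n\binom{n}{k}R_{k+1}(x)\widetilde{W}_{n-k}(x^2),$$ $$T_{n+1}(x)=x\sum_{k=0}^n\binom{n}{k}T_k(x)\widetilde{W}_{n-k}(x^2),$$ $$T_{n+1}(x)=T_n(x)+x^2\sum_{k=0}^{n-1}\binom{n}{k}T_k(x)W_{n-k}(x^2).$$
   Context: $\mathfrak{S}_n$ is the set of permutations $\pi=\pi(1)\cdots\pi(n)$ of $\{1,\ldots,n\}$. Alternating runs: $\pi$ changes direction at position $i\in\{2,\ldots,n-1\}$ if $\pi(i-1)<\pi(i)>\pi(i+1)$ or $\pi(i-1)>\pi(i)<\pi(i+1)$. For $n\ge 2$, $\pi$ has $k$ alternating runs if it changes direction at exactly $k-1$ positions; $R(n,k)$ is the number of $\pi\in\mathfrak{S}_n$ with $k$ alternating runs. Put $R_n(x)=\sum_{k=1}^{n-1}R(n,k)x^k$ for $n\ge 2$, and by convention $R_1(x)=1$. Longest alternating subsequences: an alternating subsequence of $\pi$ of length $k$ is a subsequence $\pi(i_1),\ldots,\pi(i_k)$ with $i_1<\cdots<i_k$ and $\pi(i_1)>\pi(i_2)<\pi(i_3)>\cdots\pi(i_k)$ (starting with a descent and alternating thereafter; any sequence of length 1 qualifies). $\mathrm{as}(\pi)$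 is the maximal length of an alternating subsequence, $a_k(n)=\#\{\pi\in\mathfrak{S}_n:\mathrm{as}(\pi)=k\}$, $T_n(x)=\sum_{k=1}^n a_k(n)x^k$ for $n\ge 1$, and $T_0(x)=1$. Peaks: an interior peak of $\pi\in\mathfrak{S}_n$ is an index $i\in\{2,\ldots,n-1\}$ with $\pi(i-1)<\pi(i)>\pi(i+1)$; a left peak is an index $i\in\{1,\ldots,n-1\}$ with $\pi(i-1)<\pi(i)>\pi(i+1)$, where $\pi(0)=0$. $W(n,k)$ (resp. $\widetilde{W}(n,k)$) is the number of $\pi\in\mathfrak{S}_n$ with $k$ interior peaks (resp. $k$ left peaks). For $n\ge 1$, $W_n(x)=\sum_{k\ge 0}W(n,k)x^k$ and $\widetilde{W}_n(x)=\sum_{k\ge 0}\widetilde{W}(n,k)x^k$; also $\widetilde{W}_0(x)=1$. -}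

module Defs where

open import Data.List.Base
  using (List; []; _∷_; _++_; map; foldr; filter; length; upTo; cartesianProductWith)
open import Data.List.Extrema.Nat using (max)
open import Data.List.Relation.Unary.Unique.Propositional using (Unique)
open import Data.Nat using (ℕ; zero; suc; _+_; _*_; _∸_; _<_; _>_; _≟_; _<?_; _>?_)
open import Data.List.Relation.Unary.Unique.DecPropositional _≟_ using (unique?)
open import Data.Product using (_×_)
open import Data.Sum using (_⊎_)
open import Data.Unit using (⊤; tt)
open import Relation.Binary.PropositionalEquality using (_≡_)
open import Relation.Nullary using (yes)
open import Relation.Nullary.Decidable using (_×-dec_; _⊎-dec_)
open import Relation.Unary using (Pred; Decidable)
open import Level using (0ℓ)

infix 8 _to_

-- Empty when a > b.
_to_ : ℕ → ℕ → List ℕ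
a to b = map (a +_) (upTo (suc b ∸ a))

-- Polynomials over ℕ: coefficient lists, constant term first, compared
-- coefficientwise (so trailing zeros are irrelevant).

Poly : Set
Poly = List ℕ

coeff : Poly → ℕ → ℕ
coeff []      _       = 0
coeff (a ∷ p) zero    = a
coeff (a ∷ p) (suc k) = coeff p k

infix  4 _≈_
infixl 6 _⊕_
infixl 7 _⊗_
infixr 8 _·_
infixr 10 _^^_
infixl 9 _∘ₚ_

_≈_ : Poly → Poly → Set
p ≈ q = ∀ k → coeff p k ≡ coeff q k

_⊕_ : Poly → Poly → Poly
[]      ⊕ q       = q
(a ∷ p) ⊕ []      = a ∷ p
(a ∷ p) ⊕ (b ∷ q) = (a + b) ∷ (p ⊕ q)

_·_ : ℕ → Poly → Poly
c · p = map (c *_) p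

_⊗_ : Poly → Poly → Poly
[]      ⊗ q = []
(a ∷ p) ⊗ q = a · q ⊕ (0 ∷ (p ⊗ q))

𝟘 𝟙 X : Poly
𝟘 = []
𝟙 = 1 ∷ []
X = 0 ∷ 1 ∷ []

_^^_ : Poly → ℕ → Poly
p ^^ zero  = 𝟙
p ^^ suc k = p ⊗ p ^^ k

-- p ∘ₚ q is p(q(x)).
_∘ₚ_ : Poly → Poly → Poly
[]      ∘ₚ q = 𝟘
(a ∷ p) ∘ₚ q = (a ∷ []) ⊕ q ⊗ (p ∘ₚ q)

∑ : List ℕ → (ℕ → Poly) → Poly
∑ ks f = foldr (λ k s → f k ⊕ s) 𝟘 ks

infix 5 ∑
syntax ∑ ks (λ k → p) = ∑[ k ∈ ks ] p

-- Permutations of {1,…,n} in one-line notation: the words of length n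
-- over {1,…,n} with pairwise distinct letters.

Word : Set
Word = List ℕ

words : List ℕ → ℕ → List Word
words as zero    = [] ∷ []
words as (suc m) = cartesianProductWith _∷_ as (words as m)

𝔖 : ℕ → List Word
𝔖 n = filter unique? (words (1 to n) n)

#𝔖 : (n : ℕ) {P : Pred Word 0ℓ} → Decidable P → ℕ
#𝔖 n P? = length (filter P? (𝔖 n))

-- π ⟨ i ⟩ is π(i) for 1 ≤ i ≤ n, and π ⟨ 0 ⟩ = 0.
-- (Positions beyond n get the value 0, but are never consulted below.)
infix 11 _⟨_⟩

_⟨_⟩ : Word → ℕ → ℕ
π ⟨ i ⟩ = coeff (0 ∷ π) i

-- Both predicates are only used at positions i ≥ 1.
IsPeak IsValley ChangesDirection : Word → ℕ → Set
IsPeak   π i = π ⟨ i ∸ 1 ⟩ < π ⟨ i ⟩ × π ⟨ i ⟩ > π ⟨ i + 1 ⟩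
IsValley π i = π ⟨ i ∸ 1 ⟩ > π ⟨ i ⟩ × π ⟨ i ⟩ < π ⟨ i + 1 ⟩
ChangesDirection π i = IsPeak π i ⊎ IsValley π i

isPeak? : ∀ π → Decidable (IsPeak π)
isPeak? π i = (π ⟨ i ∸ 1 ⟩ <? π ⟨ i ⟩) ×-dec (π ⟨ i ⟩ >? π ⟨ i + 1 ⟩)

isValley? : ∀ π → Decidable (IsValley π)
isValley? π i = (π ⟨ i ∸ 1 ⟩ >? π ⟨ i ⟩) ×-dec (π ⟨ i ⟩ <? π ⟨ i + 1 ⟩)

changesDirection? : ∀ π → Decidable (ChangesDirection π)
changesDirection? π i = isPeak? π i ⊎-dec isValley? π i

directionChanges interiorPeaks leftPeaks : Word → ℕ
directionChanges π = length (filter (changesDirection? π) (2 to (length π ∸ 1)))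
interiorPeaks    π = length (filter (isPeak? π) (2 to (length π ∸ 1)))
leftPeaks        π = length (filter (isPeak? π) (1 to (length π ∸ 1)))

-- Falling w : w₁ > w₂ < w₃ > ⋯ ;  Rising w : w₁ < w₂ > w₃ < ⋯
Falling Rising : Word → Set
Falling []          = ⊤
Falling (x ∷ [])    = ⊤
Falling (x ∷ y ∷ w) = x > y × Rising (y ∷ w)
Rising  []          = ⊤
Rising  (x ∷ [])    = ⊤
Rising  (x ∷ y ∷ w) = x < y × Falling (y ∷ w)

falling? : Decidable Falling
rising?  : Decidable Rising
falling? []          = yes tt
falling? (x ∷ [])    = yes tt
falling? (x ∷ y ∷ w) = (x >? y) ×-dec rising? (y ∷ w)
rising?  []          = yes tt
rising?  (x ∷ [])    = yes tt
rising?  (x ∷ y ∷ w) = (x <? y) ×-dec falling? (y ∷ w)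

subsequences : Word → List Word
subsequences []      = [] ∷ []
subsequences (x ∷ w) = subsequences w ++ map (x ∷_) (subsequences w)

-- The empty subsequence also counts as alternating here; this does not
-- affect the maximum for a nonempty word.
as : Word → ℕ
as π = max 0 (map length (filter falling? (subsequences π)))

-- Permutations with k alternating runs, i.e. exactly k - 1 direction changes.
#runs : ℕ → ℕ → ℕ
#runs n k = #𝔖 n (λ π → suc (directionChanges π) ≟ k)

#as : ℕ → ℕ → ℕ
#as n k = #𝔖 n (λ π → as π ≟ k)

#interiorPeaks : ℕ → ℕ → ℕ
#interiorPeaks n k = #𝔖 n (λ π → interiorPeaks π ≟ k)

#leftPeaks : ℕ → ℕ → ℕ
#leftPeaks n k = #𝔖 n (λ π → leftPeaks π ≟ k)

-- R 0 is a dummy value: R n is meaningful for n ≥ 1 only.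
R : ℕ → Poly
R 0               = 𝟘
R 1               = 𝟙
R n@(suc (suc _)) = ∑[ k ∈ 1 to (n ∸ 1) ] (#runs n k · X ^^ k)

T : ℕ → Poly
T 0         = 𝟙
T n@(suc _) = ∑[ k ∈ 1 to n ] (#as n k · X ^^ k)

-- A permutation of {1,…,n} has at most n (interior or left) peaks, so the
-- sums over all k ≥ 0 may stop at n.
W : ℕ → Poly
W n = ∑[ k ∈ 0 to n ] (#interiorPeaks n k · X ^^ k)

W~ : ℕ → Poly
W~ 0         = 𝟙
W~ n@(suc _) = ∑[ k ∈ 0 to n ] (#leftPeaks n k · X ^^ k)

{-# OPTIONS --safe #-}
-- Let D be the derivation with D w = wx, D x = xy, D y = x².  Inserting the
-- letter n + 1 in all possible ways into π ∈ 𝔖 n acts like D on the monomials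
--   w xᵏ yⁿ⁻ᵏ            (k = as π),
--   w² xᵏ yⁿ⁻¹⁻ᵏ         (k = number of alternating runs of π),
--   x²ᵏ⁺¹ yⁿ⁻²ᵏ          (k = number of left peaks of π),
--   x²ᵏ⁺² yⁿ⁻¹⁻²ᵏ        (k = number of interior peaks of π).
-- Hence, at w = y = 1, Dⁿ w = Tₙ, Dⁿ w² = Rₙ₊₁, Dⁿ x = x W~ₙ(x²), and, for n ≥ 1,
-- Dⁿ y = x² Wₙ(x²).  The identities are instances of the Leibniz rule for the
-- products w·w, w·wx (as D w² = 2w²x), w²·x, w·x (as D w = wx), and w·y (as
-- D(wx) = D(wy)).  All four statistics are governed by the number of direction
-- changes of a word: as π is one more than that of 0π for nonempty π, and π has
-- ⌊as π / 2⌋ left peaks.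

module Submission where

open import Defs
open import Data.Bool using (if_then_else_)
open import Data.List.Base
  using (List; []; _∷_; _++_; map; filter; length; upTo; applyUpTo; concatMap)
open import Data.List.Extrema.Nat using (v≤max⁺; max≤v⁺)
open import Data.List.Membership.Propositional using (_∈_; _∉_; find; lose)
open import Data.List.Membership.Propositional.Properties
  using ( ∈-map⁺; ∈-map⁻; ∈-upTo⁺; ∈-upTo⁻; ∈-++⁺ˡ; ∈-++⁺ʳ; ∈-++⁻; ∈-∃++; ∈-filter⁺; ∈-filter⁻
        ; ∈-concatMap⁺; ∈-concatMap⁻; ∈-cartesianProductWith⁺; ∈-cartesianProductWith⁻)
open import Data.List.Membership.Propositional.Properties.WithK using (unique∧set⇒bag)
open import Data.List.Properties
  using ( map-∘; map-++; ∷-injective; ∷-injectiveʳ; length-map; length-upTo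
        ; filter-all; filter-accept; filter-reject)
open import Data.List.Relation.Binary.BagAndSetEquality using (∼bag⇒↭)
open import Data.List.Relation.Binary.Disjoint.Propositional using (Disjoint)
open import Data.List.Relation.Binary.Permutation.Propositional
  using (_↭_; prep; swap; ↭-refl; ↭-sym; ↭-trans; ↭⇒↭ₛ)
open import Data.List.Relation.Binary.Permutation.Propositional.Properties
  using (All-resp-↭; ∈-resp-↭; ↭-length; shift; map⁺)
import Data.List.Relation.Binary.Permutation.Setoid.Properties as ↭ₛ
open import Data.List.Relation.Binary.Subset.Propositional using (_⊆_)
open import Data.List.Relation.Unary.All as All using (All; []; _∷_)
open import Data.List.Relation.Unary.AllPairs using ([]; _∷_)
open import Data.List.Relation.Unary.Any using (here; there)
open import Data.List.Relation.Unary.Unique.Propositional using (Unique)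
import Data.List.Relation.Unary.Unique.Propositional.Properties as Unique
open import Data.Nat
open import Data.Nat.Combinatorics
  using (_C_; nCk+nC[k+1]≡[n+1]C[k+1]; k>n⇒nCk≡0; nCk≡nC[n∸k]; nCn≡1)
open import Data.Nat.ListAction using (sum)
open import Data.Nat.ListAction.Properties using (sum-++; sum-↭)
open import Data.Nat.Properties
open import Data.Nat.Tactic.RingSolver using (solve-∀)
open import Data.Product using (_×_; _,_; proj₁; proj₂; ∃; ∃₂)
open import Data.Sum using (_⊎_; inj₁; inj₂)
open import Data.Unit using (tt)
open import Function using (_∘_; id; mk⇔)
open import Level using (0ℓ)
open import Relation.Binary.PropositionalEquality
open import Relation.Nullary using (Dec; does; ¬_; ¬?; yes; no; contradiction)
open import Relation.Nullary.Decidable using (_×-dec_; _⊎-dec_)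
open import Relation.Unary using (Pred; Decidable)

open import Algebra.Properties.CommutativeSemigroup +-commutativeSemigroup
  using (interchange; x∙yz≈y∙xz)
open import Data.List.Membership.DecPropositional _≟_ using (_∈?_)
open import Data.List.Relation.Unary.Unique.DecPropositional _≟_ using (unique?)
open ≡-Reasoning

-- Why insertion acts like D: among the n + 1 slots of a permutation with as π = k, exactly one
-- raises k by 1, k slots keep it and n - k raise it by 2. These are the terms that D produces from
-- w, from the k letters x and from the n - k letters y. D raises the joint degree in x and y by
-- one, so this degree records the length and y can be set to 1 at the end; until then its exponent
-- is needed as the coefficient of the next step. The obstacle to counting slots along a word is
-- that the statistic of a suffix depends on the direction in which its first letter was reached.
-- Hence two mutually recursive counts and two simultaneous insertion formulas. Derivatives are
-- unfolded from the inside: `𝒟 (suc n)` of a monomial is `𝒟 n` of its derivative. The sum of the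
-- m-th derivatives of the monomials of all `π ∈ 𝔖 n` then depends on n + m only, and removing the
-- largest letter trades n for m until a single starting word remains.

private variable
  A B : Set

-- Finite sums, binomial convolution and the Leibniz rule

total : (A → ℕ) → List A → ℕ
total f xs = sum (map f xs)

total-cong : {f g : A → ℕ} (xs : List A) → (∀ {x} → x ∈ xs → f x ≡ g x) →
             total f xs ≡ total g xs
total-cong []       f≡g = refl
total-cong (x ∷ xs) f≡g = cong₂ _+_ (f≡g (here refl)) (total-cong xs (f≡g ∘ there))

total-+ : (f g : A → ℕ) (xs : List A) →
          total (λ x → f x + g x) xs ≡ total f xs + total g xs
total-+ f g []       = refl
total-+ f g (x ∷ xs) = trans (cong (f x + g x +_) (total-+ f g xs))
                             (interchange (f x) (g x) (total f xs) (total g xs))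

total-0 : (xs : List A) → total (λ _ → 0) xs ≡ 0
total-0 []       = refl
total-0 (_ ∷ xs) = total-0 xs

total-map : (f : B → ℕ) (g : A → B) (xs : List A) → total f (map g xs) ≡ total (f ∘ g) xs
total-map f g xs = cong sum (sym (map-∘ xs))

total-concatMap : (f : B → ℕ) (g : A → List B) (xs : List A) →
                  total f (concatMap g xs) ≡ total (total f ∘ g) xs
total-concatMap f g []       = refl
total-concatMap f g (x ∷ xs) = begin
  total f (g x ++ concatMap g xs)          ≡⟨ cong sum (map-++ f (g x) (concatMap g xs)) ⟩
  sum (map f (g x) ++ map f (concatMap g xs)) ≡⟨ sum-++ (map f (g x)) _ ⟩
  total f (g x) + total f (concatMap g xs) ≡⟨ cong (total f (g x) +_) (total-concatMap f g xs) ⟩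
  total f (g x) + total (total f ∘ g) xs   ∎

sum< : ℕ → (ℕ → ℕ) → ℕ
sum< zero    f = 0
sum< (suc n) f = f 0 + sum< n (f ∘ suc)

sum<-cong : ∀ n {f g} → (∀ {k} → k < n → f k ≡ g k) → sum< n f ≡ sum< n g
sum<-cong zero    f≡g = refl
sum<-cong (suc n) f≡g = cong₂ _+_ (f≡g z<s) (sum<-cong n (f≡g ∘ s<s))

sum<-+ : ∀ n f g → sum< n (λ k → f k + g k) ≡ sum< n f + sum< n g
sum<-+ zero    f g = refl
sum<-+ (suc n) f g = trans (cong (f 0 + g 0 +_) (sum<-+ n (f ∘ suc) (g ∘ suc)))
                           (interchange (f 0) (g 0) (sum< n (f ∘ suc)) (sum< n (g ∘ suc)))

sum<-* : ∀ n c f → sum< n (λ k → c * f k) ≡ c * sum< n f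
sum<-* zero    c f = sym (*-zeroʳ c)
sum<-* (suc n) c f = trans (cong (c * f 0 +_) (sum<-* n c (f ∘ suc)))
                           (sym (*-distribˡ-+ c (f 0) _))

sum<-last : ∀ n f → sum< (suc n) f ≡ sum< n f + f n
sum<-last zero    f = +-identityʳ (f 0)
sum<-last (suc n) f = trans (cong (f 0 +_) (sum<-last n (f ∘ suc))) (sym (+-assoc (f 0) _ _))

total-applyUpTo : ∀ (f : ℕ → ℕ) g n → total f (applyUpTo g n) ≡ sum< n (f ∘ g)
total-applyUpTo f g zero    = refl
total-applyUpTo f g (suc n) = cong (f (g 0) +_) (total-applyUpTo f (g ∘ suc) n)

total-to : ∀ f a b → total f (a to b) ≡ sum< (suc b ∸ a) (λ i → f (a + i))
total-to f a b = trans (total-map f (a +_) (upTo (suc b ∸ a)))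
                       (total-applyUpTo (λ i → f (a + i)) id (suc b ∸ a))

binom : ℕ → (ℕ → ℕ → ℕ) → ℕ
binom n B = sum< (suc n) (λ k → (n C k) * B k (n ∸ k))

nC0≡1 : ∀ n → n C 0 ≡ 1
nC0≡1 n = trans (nCk≡nC[n∸k] {0} {n} z≤n) (nCn≡1 n)

-- Pascal's rule splits each coefficient in two. The half with `n C suc k`, shifted by one and
-- completed by the term at k = 0, is the sum for `B a (suc b)`. In the Leibniz rule the two halves
-- are the cases where one more D hits the first or the second factor.
binom-suc : ∀ n B → binom (suc n) B ≡ binom n (λ a b → B (suc a) b + B a (suc b))
binom-suc n B = begin
  (suc n C 0) * B 0 (suc n) + sum< (suc n) (λ k → (suc n C suc k) * B (suc k) (n ∸ k))
    ≡⟨ cong₂ _+_ (cong (_* B 0 (suc n)) (trans (nC0≡1 (suc n)) (sym (nC0≡1 n))))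
                 (trans (sum<-cong (suc n) (λ {k} _ → pascal k))
                        (sum<-+ (suc n) left right)) ⟩
  first + (sum< (suc n) left + sum< (suc n) right)
    ≡⟨ cong (λ r → first + (sum< (suc n) left + r))
         (trans (sum<-last n right) (cong (sum< n right +_) last≡0)) ⟩
  first + (sum< (suc n) left + (sum< n right + 0))
    ≡⟨ rearrange first (sum< (suc n) left) (sum< n right) ⟩
  sum< (suc n) left + (first + sum< n right)
    ≡⟨ cong (λ r → sum< (suc n) left + (first + r)) (sum<-cong n reindex) ⟩
  sum< (suc n) left + sum< (suc n) right′
    ≡⟨ sum<-+ (suc n) left right′ ⟨
  sum< (suc n) (λ k → left k + right′ k)
    ≡⟨ sum<-cong (suc n) (λ {k} _ → sym (*-distribˡ-+ (n C k) (B (suc k) (n ∸ k)) (B k (suc (n ∸ k))))) ⟩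
  binom n (λ a b → B (suc a) b + B a (suc b)) ∎
  where
  first : ℕ
  first = (n C 0) * B 0 (suc n)
  left right right′ : ℕ → ℕ
  left   k = (n C k) * B (suc k) (n ∸ k)
  right  k = (n C suc k) * B (suc k) (n ∸ k)
  right′ k = (n C k) * B k (suc (n ∸ k))
  pascal : ∀ k → (suc n C suc k) * B (suc k) (n ∸ k) ≡ left k + right k
  pascal k = trans (cong (_* B (suc k) (n ∸ k)) (sym (nCk+nC[k+1]≡[n+1]C[k+1] n k)))
                   (*-distribʳ-+ (B (suc k) (n ∸ k)) (n C k) (n C suc k))
  last≡0 : right n ≡ 0
  last≡0 = cong (_* B (suc n) (n ∸ n)) (k>n⇒nCk≡0 (n<1+n n))
  rearrange : ∀ a b c → a + (b + (c + 0)) ≡ b + (a + c)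
  rearrange = solve-∀
  reindex : ∀ {k} → k < n → right k ≡ right′ (suc k)
  reindex {k} k<n = cong (λ m → (n C suc k) * B (suc k) m) (+-∸-assoc 1 k<n)

binom-cong : ∀ n {B B′} → (∀ a b → B a b ≡ B′ a b) → binom n B ≡ binom n B′
binom-cong n B≡B′ = sum<-cong (suc n) (λ {k} _ → cong ((n C k) *_) (B≡B′ k (n ∸ k)))

binom-+ : ∀ n B B′ → binom n (λ a b → B a b + B′ a b) ≡ binom n B + binom n B′
binom-+ n B B′ = trans (sum<-cong (suc n) (λ {k} _ → *-distribˡ-+ (n C k) (B k (n ∸ k)) (B′ k (n ∸ k))))
                       (sum<-+ (suc n) (λ k → (n C k) * B k (n ∸ k)) (λ k → (n C k) * B′ k (n ∸ k)))

binom-* : ∀ n c B → binom n (λ a b → c * B a b) ≡ c * binom n B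
binom-* n c B = trans (sum<-cong (suc n) (λ {k} _ → exchange (n C k) c (B k (n ∸ k))))
                      (sum<-* (suc n) c (λ k → (n C k) * B k (n ∸ k)))
  where
  exchange : ∀ a b d → a * (b * d) ≡ b * (a * d)
  exchange = solve-∀

-- 𝒟 n i j m φ is the n-th derivative of wⁱxʲyᵐ for the grammar
-- w → wx, x → xy, y → x², at w = y = 1, with φ k substituted for xᵏ.
𝒟 : (n i j m : ℕ) → (ℕ → ℕ) → ℕ
𝒟 zero    i j m φ = φ j
𝒟 (suc n) i j m φ =
  i * 𝒟 n i (suc j) m φ + (j * 𝒟 n i j (suc m) φ + m * 𝒟 n i (2 + j) (pred m) φ)

𝒟-cong : ∀ n i j m {φ ψ} → (∀ k → φ k ≡ ψ k) → 𝒟 n i j m φ ≡ 𝒟 n i j m ψ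
𝒟-cong zero    i j m φ≡ψ = φ≡ψ j
𝒟-cong (suc n) i j m φ≡ψ =
  cong₂ _+_ (cong (i *_) (𝒟-cong n i (suc j) m φ≡ψ))
    (cong₂ _+_ (cong (j *_) (𝒟-cong n i j (suc m) φ≡ψ))
               (cong (m *_) (𝒟-cong n i (2 + j) (pred m) φ≡ψ)))

𝒟-+ : ∀ n i j m φ ψ → 𝒟 n i j m (λ k → φ k + ψ k) ≡ 𝒟 n i j m φ + 𝒟 n i j m ψ
𝒟-+ zero    i j m φ ψ = refl
𝒟-+ (suc n) i j m φ ψ
  rewrite 𝒟-+ n i (suc j) m φ ψ | 𝒟-+ n i j (suc m) φ ψ | 𝒟-+ n i (2 + j) (pred m) φ ψ
  = distribute i j m (𝒟 n i (suc j) m φ) _ (𝒟 n i j (suc m) φ) _ (𝒟 n i (2 + j) (pred m) φ) _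
  where
  distribute : ∀ i j m a a′ b b′ c c′ →
    i * (a + a′) + (j * (b + b′) + m * (c + c′)) ≡
    i * a + (j * b + m * c) + (i * a′ + (j * b′ + m * c′))
  distribute = solve-∀

𝒟-* : ∀ n i j m c φ → 𝒟 n i j m (λ k → c * φ k) ≡ c * 𝒟 n i j m φ
𝒟-* zero    i j m c φ = refl
𝒟-* (suc n) i j m c φ
  rewrite 𝒟-* n i (suc j) m c φ | 𝒟-* n i j (suc m) c φ | 𝒟-* n i (2 + j) (pred m) c φ
  = distribute c i j m (𝒟 n i (suc j) m φ) (𝒟 n i j (suc m) φ) (𝒟 n i (2 + j) (pred m) φ)
  where
  distribute : ∀ c i j m a b d →
    i * (c * a) + (j * (c * b) + m * (c * d)) ≡ c * (i * a + (j * b + m * d))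
  distribute = solve-∀

𝒟-product : (i j m i′ j′ m′ : ℕ) → (ℕ → ℕ) → ℕ → ℕ → ℕ
𝒟-product i j m i′ j′ m′ φ a b = 𝒟 a i j m (λ p → 𝒟 b i′ j′ m′ (λ q → φ (p + q)))

-- Induction on n for all exponents at once, since D turns a monomial into three others. Each letter
-- belongs to one of the two factors, which gives six terms: three form D of the first factor, three
-- D of the second, and `binom-suc` recombines them.
leibniz : ∀ n i j m i′ j′ m′ φ →
  𝒟 n (i + i′) (j + j′) (m + m′) φ ≡ binom n (𝒟-product i j m i′ j′ m′ φ)
leibniz zero    i j m i′ j′ m′ φ = sym (trans (+-identityʳ _) (+-identityʳ _))
leibniz (suc n) i j m i′ j′ m′ φ = begin
  (i + i′) * 𝒟 n (i + i′) (suc (j + j′)) (m + m′) φ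
    + ((j + j′) * 𝒟 n (i + i′) (j + j′) (suc (m + m′)) φ
      + (m + m′) * 𝒟 n (i + i′) (2 + (j + j′)) (pred (m + m′)) φ)
    ≡⟨ cong₂ _+_ (split i i′ w₁ w₂) (cong₂ _+_ (split j j′ x₁ x₂) (y-split m m′)) ⟩
  i * binom n W₁ + i′ * binom n W₂
    + (j * binom n X₁ + j′ * binom n X₂ + (m * binom n Y₁ + m′ * binom n Y₂))
    ≡⟨ regroup (i * binom n W₁) (i′ * binom n W₂) (j * binom n X₁) (j′ * binom n X₂)
         (m * binom n Y₁) (m′ * binom n Y₂) ⟩
  i * binom n W₁ + (j * binom n X₁ + m * binom n Y₁)
    + (i′ * binom n W₂ + (j′ * binom n X₂ + m′ * binom n Y₂))
    ≡⟨ cong₂ _+_ (combine i j m W₁ X₁ Y₁) (combine i′ j′ m′ W₂ X₂ Y₂) ⟩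
  binom n (λ a b → i * W₁ a b + (j * X₁ a b + m * Y₁ a b))
    + binom n (λ a b → i′ * W₂ a b + (j′ * X₂ a b + m′ * Y₂ a b))
    ≡⟨ cong (binom n (λ a b → F (suc a) b) +_) (binom-cong n inner) ⟩
  binom n (λ a b → F (suc a) b) + binom n (λ a b → F a (suc b))
    ≡⟨ binom-+ n (λ a b → F (suc a) b) (λ a b → F a (suc b)) ⟨
  binom n (λ a b → F (suc a) b + F a (suc b))
    ≡⟨ binom-suc n F ⟨
  binom (suc n) F ∎
  where
  F W₁ W₂ X₁ X₂ Y₁ Y₂ : ℕ → ℕ → ℕ
  F  = 𝒟-product i j m i′ j′ m′ φ
  W₁ = 𝒟-product i (suc j) m i′ j′ m′ φ
  W₂ = 𝒟-product i j m i′ (suc j′) m′ φ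
  X₁ = 𝒟-product i j (suc m) i′ j′ m′ φ
  X₂ = 𝒟-product i j m i′ j′ (suc m′) φ
  Y₁ = 𝒟-product i (2 + j) (pred m) i′ j′ m′ φ
  Y₂ = 𝒟-product i j m i′ (2 + j′) (pred m′) φ
  w₁ : 𝒟 n (i + i′) (suc (j + j′)) (m + m′) φ ≡ binom n W₁
  w₁ = leibniz n i (suc j) m i′ j′ m′ φ
  w₂ : 𝒟 n (i + i′) (suc (j + j′)) (m + m′) φ ≡ binom n W₂
  w₂ = trans (cong (λ l → 𝒟 n (i + i′) l (m + m′) φ) (sym (+-suc j j′)))
             (leibniz n i j m i′ (suc j′) m′ φ)
  x₁ : 𝒟 n (i + i′) (j + j′) (suc (m + m′)) φ ≡ binom n X₁
  x₁ = leibniz n i j (suc m) i′ j′ m′ φ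
  x₂ : 𝒟 n (i + i′) (j + j′) (suc (m + m′)) φ ≡ binom n X₂
  x₂ = trans (cong (λ l → 𝒟 n (i + i′) (j + j′) l φ) (sym (+-suc m m′)))
             (leibniz n i j m i′ j′ (suc m′) φ)
  split : ∀ c c′ {z z₁ z₂} → z ≡ z₁ → z ≡ z₂ → (c + c′) * z ≡ c * z₁ + c′ * z₂
  split c c′ {z} refl refl = *-distribʳ-+ z c c′
  -- `pred (l + l′)` equals `pred l + l′` only for positive l; at l = 0 the coefficient makes both
  -- sides 0.
  y-split₁ : ∀ l l′ → l * 𝒟 n (i + i′) (2 + (j + j′)) (pred (l + l′)) φ
           ≡ l * binom n (𝒟-product i (2 + j) (pred l) i′ j′ l′ φ)
  y-split₁ zero    l′ = refl
  y-split₁ (suc l) l′ = cong (suc l *_) (leibniz n i (2 + j) l i′ j′ l′ φ)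
  y-split₂ : ∀ l l′ → l′ * 𝒟 n (i + i′) (2 + (j + j′)) (pred (l + l′)) φ
           ≡ l′ * binom n (𝒟-product i j l i′ (2 + j′) (pred l′) φ)
  y-split₂ l zero     = refl
  y-split₂ l (suc l′) = cong (suc l′ *_)
    (trans (cong₂ (λ u v → 𝒟 n (i + i′) u v φ)
                  (sym (trans (+-suc j (suc j′)) (cong suc (+-suc j j′))))
                  (cong pred (+-suc l l′)))
           (leibniz n i j l i′ (2 + j′) l′ φ))
  y-split : ∀ l l′ → (l + l′) * 𝒟 n (i + i′) (2 + (j + j′)) (pred (l + l′)) φ
          ≡ l * binom n (𝒟-product i (2 + j) (pred l) i′ j′ l′ φ)
            + l′ * binom n (𝒟-product i j l i′ (2 + j′) (pred l′) φ)
  y-split l l′ = trans (*-distribʳ-+ (𝒟 n (i + i′) (2 + (j + j′)) (pred (l + l′)) φ) l l′)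
                       (cong₂ _+_ (y-split₁ l l′) (y-split₂ l l′))
  regroup : ∀ a a′ b b′ c c′ → a + a′ + (b + b′ + (c + c′)) ≡ a + (b + c) + (a′ + (b′ + c′))
  regroup = solve-∀
  combine : ∀ c d e U V Z → c * binom n U + (d * binom n V + e * binom n Z)
          ≡ binom n (λ a b → c * U a b + (d * V a b + e * Z a b))
  combine c d e U V Z = sym (trans (binom-+ n (λ a b → c * U a b) (λ a b → d * V a b + e * Z a b))
    (cong₂ _+_ (binom-* n c U) (trans (binom-+ n (λ a b → d * V a b) (λ a b → e * Z a b))
      (cong₂ _+_ (binom-* n d V) (binom-* n e Z)))))
  -- `F (suc a) b` unfolds by definition, but here D falls on the inner factor, and its three terms
  -- must pass through the outer `𝒟 a` by linearity.
  inner : ∀ a b → i′ * W₂ a b + (j′ * X₂ a b + m′ * Y₂ a b) ≡ F a (suc b)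
  inner a b = sym (trans (𝒟-+ a i j m _ _) (cong₂ _+_ (𝒟-* a i j m i′ _)
    (trans (𝒟-+ a i j m _ _) (cong₂ _+_ (𝒟-* a i j m j′ _) (𝒟-* a i j m m′ _)))))

-- Polynomials as functionals

-- A polynomial as the linear functional that sends xᵏ to φ k; the product
-- then becomes an iterated sum, and ≈ is equality on the functions δ k.
⟦_⟧ : Poly → (ℕ → ℕ) → ℕ
⟦ []    ⟧ φ = 0
⟦ a ∷ p ⟧ φ = a * φ 0 + ⟦ p ⟧ (φ ∘ suc)

⟦⟧-cong : ∀ p {φ ψ} → (∀ k → φ k ≡ ψ k) → ⟦ p ⟧ φ ≡ ⟦ p ⟧ ψ
⟦⟧-cong []      φ≡ψ = refl
⟦⟧-cong (a ∷ p) φ≡ψ = cong₂ _+_ (cong (a *_) (φ≡ψ 0)) (⟦⟧-cong p (φ≡ψ ∘ suc))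

δ : ℕ → ℕ → ℕ
δ zero    zero    = 1
δ zero    (suc j) = 0
δ (suc k) zero    = 0
δ (suc k) (suc j) = δ k j

⟦⟧-0 : ∀ p → ⟦ p ⟧ (λ _ → 0) ≡ 0
⟦⟧-0 []      = refl
⟦⟧-0 (a ∷ p) = cong₂ _+_ (*-zeroʳ a) (⟦⟧-0 p)

⟦⟧-δ : ∀ p k → ⟦ p ⟧ (δ k) ≡ coeff p k
⟦⟧-δ []      k       = refl
⟦⟧-δ (a ∷ p) zero    = trans (cong₂ _+_ (*-identityʳ a) (⟦⟧-0 p)) (+-identityʳ a)
⟦⟧-δ (a ∷ p) (suc k) = cong₂ _+_ (*-zeroʳ a) (⟦⟧-δ p k)

⟦⟧⇒≈ : ∀ p q → (∀ φ → ⟦ p ⟧ φ ≡ ⟦ q ⟧ φ) → p ≈ q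
⟦⟧⇒≈ p q p≡q k = trans (sym (⟦⟧-δ p k)) (trans (p≡q (δ k)) (⟦⟧-δ q k))

⟦⟧-⊕ : ∀ p q φ → ⟦ p ⊕ q ⟧ φ ≡ ⟦ p ⟧ φ + ⟦ q ⟧ φ
⟦⟧-⊕ []      q       φ = refl
⟦⟧-⊕ (a ∷ p) []      φ = sym (+-identityʳ _)
⟦⟧-⊕ (a ∷ p) (b ∷ q) φ =
  trans (cong ((a + b) * φ 0 +_) (⟦⟧-⊕ p q (φ ∘ suc)))
        (rearrange a b (φ 0) (⟦ p ⟧ (φ ∘ suc)) (⟦ q ⟧ (φ ∘ suc)))
  where
  rearrange : ∀ a b x y z → (a + b) * x + (y + z) ≡ a * x + y + (b * x + z)
  rearrange = solve-∀

⟦⟧-· : ∀ c p φ → ⟦ c · p ⟧ φ ≡ c * ⟦ p ⟧ φ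
⟦⟧-· c []      φ = sym (*-zeroʳ c)
⟦⟧-· c (a ∷ p) φ =
  trans (cong (c * a * φ 0 +_) (⟦⟧-· c p (φ ∘ suc)))
        (rearrange c a (φ 0) (⟦ p ⟧ (φ ∘ suc)))
  where
  rearrange : ∀ c a x y → c * a * x + c * y ≡ c * (a * x + y)
  rearrange = solve-∀

⟦⟧-⊗ : ∀ p q φ → ⟦ p ⊗ q ⟧ φ ≡ ⟦ p ⟧ (λ a → ⟦ q ⟧ (λ b → φ (a + b)))
⟦⟧-⊗ []      q φ = refl
⟦⟧-⊗ (a ∷ p) q φ = trans (⟦⟧-⊕ (a · q) (0 ∷ (p ⊗ q)) φ)
                         (cong₂ _+_ (⟦⟧-· a q φ) (⟦⟧-⊗ p q (φ ∘ suc)))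

⟦⟧-X⊗ : ∀ p φ → ⟦ X ⊗ p ⟧ φ ≡ ⟦ p ⟧ (φ ∘ suc)
⟦⟧-X⊗ p φ = trans (⟦⟧-⊗ X p φ) (trans (+-identityʳ _) (+-identityʳ _))

⟦⟧-2X⊗ : ∀ p φ → ⟦ 2 · X ⊗ p ⟧ φ ≡ 2 * ⟦ p ⟧ (φ ∘ suc)
⟦⟧-2X⊗ p φ = trans (⟦⟧-⊗ (2 · X) p φ) (+-identityʳ _)

⟦⟧-X²⊗ : ∀ p φ → ⟦ X ^^ 2 ⊗ p ⟧ φ ≡ ⟦ p ⟧ (λ k → φ (2 + k))
⟦⟧-X²⊗ p φ = trans (⟦⟧-⊗ (X ^^ 2) p φ) (trans (+-identityʳ _) (+-identityʳ _))

⟦⟧-X^^ : ∀ k φ → ⟦ X ^^ k ⟧ φ ≡ φ k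
⟦⟧-X^^ zero    φ = trans (+-identityʳ _) (+-identityʳ _)
⟦⟧-X^^ (suc k) φ = trans (⟦⟧-X⊗ (X ^^ k) φ) (⟦⟧-X^^ k (φ ∘ suc))

⟦⟧-∘ₚX² : ∀ p φ → ⟦ p ∘ₚ X ^^ 2 ⟧ φ ≡ ⟦ p ⟧ (λ k → φ (2 * k))
⟦⟧-∘ₚX² []      φ = refl
⟦⟧-∘ₚX² (a ∷ p) φ = trans
  (⟦⟧-⊕ (a ∷ []) (X ^^ 2 ⊗ (p ∘ₚ X ^^ 2)) φ)
  (cong₂ _+_ (+-identityʳ (a * φ 0))
    (trans (⟦⟧-X²⊗ (p ∘ₚ X ^^ 2) φ)
      (trans (⟦⟧-∘ₚX² p (λ k → φ (2 + k)))
             (⟦⟧-cong p (λ k → cong φ (sym (*-suc 2 k)))))))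

⟦⟧-∑ : ∀ ks f φ → ⟦ ∑ ks f ⟧ φ ≡ total (λ k → ⟦ f k ⟧ φ) ks
⟦⟧-∑ []       f φ = refl
⟦⟧-∑ (k ∷ ks) f φ = trans (⟦⟧-⊕ (f k) (∑ ks f) φ) (cong (⟦ f k ⟧ φ +_) (⟦⟧-∑ ks f φ))

-- The distribution of a statistic and its generating polynomial

to-unique : ∀ a b → Unique (a to b)
to-unique a b = Unique.map⁺ (+-cancelˡ-≡ a _ _) (Unique.upTo⁺ (suc b ∸ a))

∈-to⁺ : ∀ {a b k} → a ≤ k → k ≤ b → k ∈ a to b
∈-to⁺ {a} {b} {k} a≤k k≤b =
  subst (_∈ a to b) (m+[n∸m]≡n a≤k) (∈-map⁺ (a +_) (∈-upTo⁺ (∸-monoˡ-< (s≤s k≤b) a≤k)))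

∈-to⁻ : ∀ {a b k} → k ∈ a to b → a ≤ k × k ≤ b
∈-to⁻ {a} {b} k∈ with i , i∈ , refl ← ∈-map⁻ (a +_) k∈ =
  m≤m+n a i , ≤-pred (+-monoʳ-<-∸ a (suc b) (∈-upTo⁻ i∈))
  where
  +-monoʳ-<-∸ : ∀ a c {i} → i < c ∸ a → a + i < c
  +-monoʳ-<-∸ zero    c       i<c   = i<c
  +-monoʳ-<-∸ (suc a) (suc c) i<c∸a = s<s (+-monoʳ-<-∸ a c i<c∸a)

⟨_⟩? : {P : Set} → Dec P → ℕ
⟨ P? ⟩? = if does P? then 1 else 0

length-filter-∷ : {P : Pred A 0ℓ} (P? : Decidable P) (x : A) (xs : List A) →
                  length (filter P? (x ∷ xs)) ≡ ⟨ P? x ⟩? + length (filter P? xs)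
length-filter-∷ P? x xs with P? x
... | yes _ = refl
... | no  _ = refl

⟨yes⟩ : {P : Set} (P? : Dec P) → P → ⟨ P? ⟩? ≡ 1
⟨yes⟩ (yes _) p = refl
⟨yes⟩ (no ¬p) p = contradiction p ¬p

⟨no⟩ : {P : Set} (P? : Dec P) → ¬ P → ⟨ P? ⟩? ≡ 0
⟨no⟩ (yes p) ¬p = contradiction p ¬p
⟨no⟩ (no _)  ¬p = refl

total-indicator : ∀ (φ : ℕ → ℕ) {j} {ks} → Unique ks → j ∈ ks →
                  total (λ k → ⟨ j ≟ k ⟩? * φ k) ks ≡ φ j
total-indicator φ {j} {k ∷ ks} (j∉ks ∷ _) (here refl)
  rewrite ⟨yes⟩ (j ≟ j) refl =
  trans (cong₂ _+_ (+-identityʳ (φ j)) (trans (total-cong ks vanish) (total-0 ks)))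
        (+-identityʳ (φ j))
  where
  vanish : ∀ {k} → k ∈ ks → ⟨ j ≟ k ⟩? * φ k ≡ 0
  vanish {k} k∈ = cong (_* φ k) (⟨no⟩ (j ≟ k) (All.lookup j∉ks k∈))
total-indicator φ {j} {k ∷ ks} (k∉ks ∷ u) (there j∈ks)
  rewrite ⟨no⟩ (j ≟ k) (≢-sym (All.lookup k∉ks j∈ks)) = total-indicator φ u j∈ks

-- After interchanging the two summations, each `x` meets its own value `g x` exactly once in `ks`.
total-distribution : ∀ (φ : ℕ → ℕ) (g : A → ℕ) {ks} → Unique ks → (xs : List A) →
  (∀ {x} → x ∈ xs → g x ∈ ks) →
  total (λ k → length (filter (λ x → g x ≟ k) xs) * φ k) ks ≡ total (φ ∘ g) xs
total-distribution φ g {ks} u []       g∈ks = total-0 ks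
total-distribution φ g {ks} u (x ∷ xs) g∈ks = begin
  total (λ k → length (filter (λ x → g x ≟ k) (x ∷ xs)) * φ k) ks
    ≡⟨ total-cong ks (λ {k} _ → trans (cong (_* φ k) (length-filter-∷ (λ x → g x ≟ k) x xs))
         (*-distribʳ-+ (φ k) ⟨ g x ≟ k ⟩? _)) ⟩
  total (λ k → ⟨ g x ≟ k ⟩? * φ k + length (filter (λ x → g x ≟ k) xs) * φ k) ks
    ≡⟨ total-+ (λ k → ⟨ g x ≟ k ⟩? * φ k) _ ks ⟩
  total (λ k → ⟨ g x ≟ k ⟩? * φ k) ks + total (λ k → length (filter (λ x → g x ≟ k) xs) * φ k) ks
    ≡⟨ cong₂ _+_ (total-indicator φ u (g∈ks (here refl)))
                 (total-distribution φ g u xs (g∈ks ∘ there)) ⟩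
  φ (g x) + total (φ ∘ g) xs ∎

⟦∑distribution⟧ : ∀ (φ : ℕ → ℕ) (g : Word → ℕ) n a b → (∀ {π} → π ∈ 𝔖 n → a ≤ g π × g π ≤ b) →
  ⟦ ∑[ k ∈ a to b ] (#𝔖 n (λ π → g π ≟ k) · X ^^ k) ⟧ φ ≡ total (φ ∘ g) (𝔖 n)
⟦∑distribution⟧ φ g n a b bounds = begin
  ⟦ ∑[ k ∈ a to b ] (#𝔖 n (λ π → g π ≟ k) · X ^^ k) ⟧ φ
    ≡⟨ ⟦⟧-∑ (a to b) (λ k → #𝔖 n (λ π → g π ≟ k) · X ^^ k) φ ⟩
  total (λ k → ⟦ #𝔖 n (λ π → g π ≟ k) · X ^^ k ⟧ φ) (a to b)
    ≡⟨ total-cong (a to b) (λ {k} _ → trans (⟦⟧-· (#𝔖 n (λ π → g π ≟ k)) (X ^^ k) φ)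
         (cong (#𝔖 n (λ π → g π ≟ k) *_) (⟦⟧-X^^ k φ))) ⟩
  total (λ k → #𝔖 n (λ π → g π ≟ k) * φ k) (a to b)
    ≡⟨ total-distribution φ g (to-unique a b) (𝔖 n)
         (λ π∈ → ∈-to⁺ (proj₁ (bounds π∈)) (proj₂ (bounds π∈))) ⟩
  total (φ ∘ g) (𝔖 n) ∎

-- Insertion of the largest letter

insertions : A → List A → List (List A)
insertions z []      = (z ∷ []) ∷ []
insertions z (x ∷ w) = (z ∷ x ∷ w) ∷ map (x ∷_) (insertions z w)

∈-insertions⁺ : ∀ (z : A) xs ys → xs ++ z ∷ ys ∈ insertions z (xs ++ ys)
∈-insertions⁺ z []       []       = here refl
∈-insertions⁺ z []       (y ∷ ys) = here refl
∈-insertions⁺ z (x ∷ xs) ys       = there (∈-map⁺ (x ∷_) (∈-insertions⁺ z xs ys))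

insertions⇒↭ : ∀ (z : A) w {v} → v ∈ insertions z w → v ↭ z ∷ w
insertions⇒↭ z []      (here refl) = ↭-refl
insertions⇒↭ z (x ∷ w) (here refl) = ↭-refl
insertions⇒↭ z (x ∷ w) (there v∈) with v′ , v′∈ , refl ← ∈-map⁻ (x ∷_) v∈ =
  ↭-trans (prep x (insertions⇒↭ z w v′∈)) (swap x z ↭-refl)

insertions-unique : ∀ (z : A) w → z ∉ w → Unique (insertions z w)
insertions-unique z []      z∉ = [] ∷ []
insertions-unique z (x ∷ w) z∉ =
  All.tabulate distinct ∷ Unique.map⁺ ∷-injectiveʳ (insertions-unique z w (z∉ ∘ there))
  where
  distinct : ∀ {v} → v ∈ map (x ∷_) (insertions z w) → z ∷ x ∷ w ≢ v
  distinct v∈ refl with _ , _ , refl ← ∈-map⁻ (x ∷_) v∈ = z∉ (here refl)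

-- A left inverse to inserting `z`, by which different words without `z` have no insertion in
-- common.
delete : ℕ → Word → Word
delete z = filter (λ x → ¬? (z ≟ x))

delete-insertions : ∀ z w {v} → z ∉ w → v ∈ insertions z w → delete z v ≡ w
delete-insertions z [] z∉ (here refl) =
  filter-reject (λ x → ¬? (z ≟ x)) (λ z≢z → z≢z refl)
delete-insertions z (x ∷ w) z∉ (here refl) =
  trans (filter-reject (λ x → ¬? (z ≟ x)) (λ z≢z → z≢z refl))
        (filter-all (λ x → ¬? (z ≟ x)) (All.tabulate λ { y∈ refl → z∉ y∈ }))
delete-insertions z (x ∷ w) z∉ (there v∈) with v′ , v′∈ , refl ← ∈-map⁻ (x ∷_) v∈ =
  trans (filter-accept (λ x → ¬? (z ≟ x)) (z∉ ∘ here))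
        (cong (x ∷_) (delete-insertions z w (z∉ ∘ there) v′∈))

concatMap-unique : ∀ (f : A → List B) (r : B → A) (xs : List A) → Unique xs →
  (∀ {x} → x ∈ xs → Unique (f x)) → (∀ {x y} → x ∈ xs → y ∈ f x → r y ≡ x) →
  Unique (concatMap f xs)
concatMap-unique f r []       []         uf rf = []
concatMap-unique f r (x ∷ xs) (x∉xs ∷ u) uf rf =
  Unique.++⁺ (uf (here refl)) (concatMap-unique f r xs u (uf ∘ there) (rf ∘ there)) disjoint
  where
  disjoint : Disjoint (f x) (concatMap f xs)
  disjoint {y} (y∈fx , y∈rest) with x′ , x′∈ , y∈fx′ ← find (∈-concatMap⁻ f {xs = xs} y∈rest) =
    All.lookup x∉xs x′∈ (trans (sym (rf (here refl) y∈fx)) (rf (there x′∈) y∈fx′))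

-- Pigeonhole: one occurrence of `x` is removed from `ys`, and the inclusion of the remaining
-- letters survives because `x` does not recur in `xs`.
unique-⊆⇒length-≤ : {xs ys : List A} → Unique xs → xs ⊆ ys → length xs ≤ length ys
unique-⊆⇒length-≤ {xs = []}     _          _  = z≤n
unique-⊆⇒length-≤ {xs = x ∷ xs} (x∉xs ∷ u) xs⊆ys
  with us , vs , refl ← ∈-∃++ (xs⊆ys (here refl)) =
  ≤-trans (s≤s (unique-⊆⇒length-≤ u xs⊆))
          (≤-reflexive (sym (↭-length (shift x us vs))))
  where
  xs⊆ : xs ⊆ us ++ vs
  xs⊆ y∈ with ∈-resp-↭ (shift x us vs) (xs⊆ys (there y∈))
  ... | here refl = contradiction refl (All.lookup x∉xs y∈)
  ... | there y∈′ = y∈′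

Unique-resp-↭ : {xs ys : List A} → xs ↭ ys → Unique xs → Unique ys
Unique-resp-↭ xs↭ys = ↭ₛ.Unique-resp-↭ (setoid _) (↭⇒↭ₛ xs↭ys)

words-unique : ∀ {ls} → Unique ls → ∀ m → Unique (words ls m)
words-unique u zero    = [] ∷ []
words-unique u (suc m) = Unique.cartesianProductWith⁺ _∷_ ∷-injective u (words-unique u m)

∈-words⁺ : ∀ {ls} w → All (_∈ ls) w → w ∈ words ls (length w)
∈-words⁺ []      []           = here refl
∈-words⁺ (x ∷ w) (x∈ ∷ w∈) = ∈-cartesianProductWith⁺ _∷_ x∈ (∈-words⁺ w w∈)

∈-words⁻ : ∀ {ls} m {w} → w ∈ words ls m → length w ≡ m × All (_∈ ls) w
∈-words⁻ zero    (here refl) = refl , []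
∈-words⁻ {ls} (suc m) w∈
  with x , w , x∈ , w∈′ , refl ← ∈-cartesianProductWith⁻ _∷_ ls (words ls m) w∈
  with len , all ← ∈-words⁻ m w∈′ = cong suc len , x∈ ∷ all

record IsPermutation (n : ℕ) (π : Word) : Set where
  constructor permutation
  field
    length≡ : length π ≡ n
    letters : All (_∈ 1 to n) π
    unique  : Unique π

open IsPermutation

∈𝔖⁺ : ∀ {n π} → IsPermutation n π → π ∈ 𝔖 n
∈𝔖⁺ {π = π} (permutation refl letters unique) = ∈-filter⁺ unique? (∈-words⁺ π letters) unique

∈𝔖⁻ : ∀ {n π} → π ∈ 𝔖 n → IsPermutation n π
∈𝔖⁻ {n} π∈ with π∈words , unique ← ∈-filter⁻ unique? {xs = words (1 to n) n} π∈
            with length≡ , letters ← ∈-words⁻ n π∈words =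
  permutation length≡ letters unique

𝔖-unique : ∀ n → Unique (𝔖 n)
𝔖-unique n = Unique.filter⁺ unique? (words-unique (to-unique 1 n) n)

1+n∉ : ∀ {n w} → All (_∈ 1 to n) w → suc n ∉ w
1+n∉ letters 1+n∈ = 1+n≰n (proj₂ (∈-to⁻ (All.lookup letters 1+n∈)))

insert-max : ∀ {n w v} → IsPermutation n w → v ∈ insertions (suc n) w → IsPermutation (suc n) v
insert-max {n} {w} (permutation refl letters unique) v∈ =
  permutation (↭-length v↭)
    (All-resp-↭ (↭-sym v↭) (∈-to⁺ z<s ≤-refl ∷ All.map weaken letters))
    (Unique-resp-↭ (↭-sym v↭) (All.tabulate (λ { y∈ refl → 1+n∉ letters y∈ }) ∷ unique))
  where
  v↭ = insertions⇒↭ (suc n) w v∈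
  weaken : ∀ {k} → k ∈ 1 to n → k ∈ 1 to suc n
  weaken k∈ with 1≤k , k≤n ← ∈-to⁻ k∈ = ∈-to⁺ 1≤k (m≤n⇒m≤1+n k≤n)

-- Otherwise n + 1 distinct letters would all lie in `1 to n`.
max∈ : ∀ {n π} → IsPermutation (suc n) π → suc n ∈ π
max∈ {n} {π} (permutation length≡ letters unique) with suc n ∈? π
... | yes 1+n∈ = 1+n∈
... | no  1+n∉π = contradiction
  (subst₂ _≤_ length≡ (trans (length-map (1 +_) (upTo n)) (length-upTo n))
    (unique-⊆⇒length-≤ unique below))
  1+n≰n
  where
  below : π ⊆ 1 to n
  below {k} k∈ with 1≤k , k≤1+n ← ∈-to⁻ (All.lookup letters k∈) =
    ∈-to⁺ 1≤k (≤-pred (≤∧≢⇒< k≤1+n (λ k≡1+n → 1+n∉π (subst (_∈ π) k≡1+n k∈))))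

remove-max : ∀ {n π} → IsPermutation (suc n) π →
             ∃ λ w → IsPermutation n w × π ∈ insertions (suc n) w
remove-max {n} {π} p with us , vs , refl ← ∈-∃++ (max∈ p) =
  us ++ vs , permutation (suc-injective (trans (sym (↭-length π↭)) (length≡ p)))
                         (All.tabulate strengthen) unique-w ,
  ∈-insertions⁺ (suc n) us vs
  where
  π↭ = shift (suc n) us vs
  letters′ : All (_∈ 1 to suc n) (suc n ∷ us ++ vs)
  letters′ = All-resp-↭ π↭ (letters p)
  unique′ : Unique (suc n ∷ us ++ vs)
  unique′ = Unique-resp-↭ π↭ (unique p)
  unique-w : Unique (us ++ vs)
  unique-w with _ ∷ u ← unique′ = u
  strengthen : ∀ {k} → k ∈ us ++ vs → k ∈ 1 to n
  strengthen k∈ with z∉ ∷ _ ← unique′ | 1≤k , k≤1+n ← ∈-to⁻ (All.lookup letters′ (there k∈)) =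
    ∈-to⁺ 1≤k (≤-pred (≤∧≢⇒< k≤1+n (≢-sym (All.lookup z∉ k∈))))

-- The orders of the two lists differ in general, but sums ignore order. Both lists are free of
-- repetitions, so having the same members suffices.
𝔖-suc : ∀ n → 𝔖 (suc n) ↭ concatMap (insertions (suc n)) (𝔖 n)
𝔖-suc n = ∼bag⇒↭ (unique∧set⇒bag (𝔖-unique (suc n))
  (concatMap-unique (insertions (suc n)) (delete (suc n)) (𝔖 n) (𝔖-unique n)
    (λ π∈ → insertions-unique (suc n) _ (1+n∉ (letters (∈𝔖⁻ π∈))))
    (λ π∈ → delete-insertions (suc n) _ (1+n∉ (letters (∈𝔖⁻ π∈)))))
  (mk⇔ forward backward))
  where
  forward : ∀ {π} → π ∈ 𝔖 (suc n) → π ∈ concatMap (insertions (suc n)) (𝔖 n)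
  forward π∈ with w , pw , π∈ins ← remove-max (∈𝔖⁻ π∈) =
    ∈-concatMap⁺ (insertions (suc n)) (lose (∈𝔖⁺ pw) π∈ins)
  backward : ∀ {π} → π ∈ concatMap (insertions (suc n)) (𝔖 n) → π ∈ 𝔖 (suc n)
  backward π∈ with w , w∈ , π∈ins ← find (∈-concatMap⁻ (insertions (suc n)) {xs = 𝔖 n} π∈) =
    ∈𝔖⁺ (insert-max (∈𝔖⁻ w∈) π∈ins)

total-𝔖-suc : ∀ f n → total f (𝔖 (suc n)) ≡ total (λ w → total f (insertions (suc n) w)) (𝔖 n)
total-𝔖-suc f n = trans (sum-↭ (map⁺ f (𝔖-suc n))) (total-concatMap f (insertions (suc n)) (𝔖 n))

-- Direction changes under insertion

-- The number of direction changes of x ∷ w, where x is regarded as having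
-- been reached by a fall (resp. a rise).  As every subsequence counted by as
-- may be preceded by 0, as π is afterFall 0 π (see as≡afterFall).
afterFall afterRise : ℕ → Word → ℕ
afterFall x []      = 0
afterFall x (y ∷ w) with x <? y
... | yes _ = suc (afterRise y w)
... | no  _ = afterFall y w
afterRise x []      = 0
afterRise x (y ∷ w) with x <? y
... | yes _ = afterRise y w
... | no  _ = suc (afterFall y w)

module _ {x y : ℕ} (w : Word) where

  afterFall-< : x < y → afterFall x (y ∷ w) ≡ suc (afterRise y w)
  afterFall-< x<y with x <? y
  ... | yes _   = refl
  ... | no  x≮y = contradiction x<y x≮y

  afterFall-≮ : ¬ x < y → afterFall x (y ∷ w) ≡ afterFall y w
  afterFall-≮ x≮y with x <? y
  ... | yes x<y = contradiction x<y x≮y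
  ... | no  _   = refl

  afterRise-< : x < y → afterRise x (y ∷ w) ≡ afterRise y w
  afterRise-< x<y with x <? y
  ... | yes _   = refl
  ... | no  x≮y = contradiction x<y x≮y

  afterRise-≮ : ¬ x < y → afterRise x (y ∷ w) ≡ suc (afterFall y w)
  afterRise-≮ x≮y with x <? y
  ... | yes x<y = contradiction x<y x≮y
  ... | no  _   = refl

-- The exponents of y are truncated differences; these bounds make them true differences, so that a
-- successor can be moved through `∸`.
afterFall≤length : ∀ x w → afterFall x w ≤ length w
afterRise≤length : ∀ x w → afterRise x w ≤ length w
afterFall≤length x []      = z≤n
afterFall≤length x (y ∷ w) with x <? y
... | yes _ = s≤s (afterRise≤length y w)
... | no  _ = m≤n⇒m≤1+n (afterFall≤length y w)
afterRise≤length x []      = z≤n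
afterRise≤length x (y ∷ w) with x <? y
... | yes _ = m≤n⇒m≤1+n (afterRise≤length y w)
... | no  _ = s≤s (afterFall≤length y w)

total-insertions-∷ : ∀ (f g : Word → ℕ) z x w → (∀ v → f (x ∷ v) ≡ g v) →
  total f (insertions z (x ∷ w)) ≡ f (z ∷ x ∷ w) + total g (insertions z w)
total-insertions-∷ f g z x w f≡g = cong (f (z ∷ x ∷ w) +_)
  (trans (total-map f (x ∷_) (insertions z w)) (total-cong (insertions z w) (λ {v} _ → f≡g v)))

afterFall-max : ∀ {x y z} w → x < z → y < z → afterFall x (z ∷ y ∷ w) ≡ 2 + afterFall y w
afterFall-max {x} {y} w x<z y<z =
  trans (afterFall-< (y ∷ w) x<z) (cong suc (afterRise-≮ w (<-asym y<z)))

afterRise-max : ∀ {x y z} w → x < z → y < z → afterRise x (z ∷ y ∷ w) ≡ suc (afterFall y w)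
afterRise-max {x} {y} w x<z y<z =
  trans (afterRise-< (y ∷ w) x<z) (afterRise-≮ w (<-asym y<z))

-- In the second equation x was reached by a rise, and the summand
-- f (1 + afterFall x w) stands for the insertion of z directly before x.
total-afterFall-insertions : ∀ (f : ℕ → ℕ) {z} x w → All (_< z) (x ∷ w) →
  let k = afterFall x w in
  total (f ∘ afterFall x) (insertions z w) ≡ f (1 + k) + (k * f k + (length w ∸ k) * f (2 + k))
total-afterRise-insertions : ∀ (f : ℕ → ℕ) {z} x w → All (_< z) (x ∷ w) →
  let k = afterRise x w in
  f (1 + afterFall x w) + total (f ∘ afterRise x) (insertions z w) ≡
  (1 + k) * f k + (f (1 + k) + (length w ∸ k) * f (2 + k))

total-afterFall-insertions f {z} x [] (x<z ∷ _) =
  cong (λ k → f k + 0) (afterFall-< [] x<z)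
total-afterFall-insertions f {z} x (y ∷ w) (x<z ∷ y<z ∷ w<z) with x <? y
... | yes x<y = begin
  total (f ∘ afterFall x) (insertions z (y ∷ w))
    ≡⟨ total-insertions-∷ (f ∘ afterFall x) (f ∘ suc ∘ afterRise y) z y w
         (λ v → cong f (afterFall-< v x<y)) ⟩
  f (afterFall x (z ∷ y ∷ w)) + total (f ∘ suc ∘ afterRise y) (insertions z w)
    ≡⟨ cong (λ k → f k + total (f ∘ suc ∘ afterRise y) (insertions z w)) (afterFall-max w x<z y<z) ⟩
  f (2 + afterFall y w) + total (f ∘ suc ∘ afterRise y) (insertions z w)
    -- The slot in front of `y` contributes exactly the extra summand that the formula after a rise
    -- asks for, with `f ∘ suc` in place of `f`.
    ≡⟨ total-afterRise-insertions (f ∘ suc) y w (y<z ∷ w<z) ⟩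
  (1 + k) * f (1 + k) + (f (2 + k) + (length w ∸ k) * f (3 + k))
    ≡⟨ x∙yz≈y∙xz ((1 + k) * f (1 + k)) (f (2 + k)) _ ⟩
  f (2 + k) + ((1 + k) * f (1 + k) + (length w ∸ k) * f (3 + k)) ∎
  where
  k = afterRise y w
... | no x≮y = begin
  total (f ∘ afterFall x) (insertions z (y ∷ w))
    ≡⟨ total-insertions-∷ (f ∘ afterFall x) (f ∘ afterFall y) z y w
         (λ v → cong f (afterFall-≮ v x≮y)) ⟩
  f (afterFall x (z ∷ y ∷ w)) + total (f ∘ afterFall y) (insertions z w)
    ≡⟨ cong₂ (λ k t → f k + t) (afterFall-max w x<z y<z)
         (total-afterFall-insertions f y w (y<z ∷ w<z)) ⟩
  f (2 + k) + (f (1 + k) + (k * f k + (length w ∸ k) * f (2 + k)))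
    ≡⟨ rearrange (f (2 + k)) (f (1 + k)) (k * f k) (length w ∸ k) ⟩
  f (1 + k) + (k * f k + suc (length w ∸ k) * f (2 + k))
    ≡⟨ cong (λ l → f (1 + k) + (k * f k + l * f (2 + k))) (+-∸-assoc 1 (afterFall≤length y w)) ⟨
  f (1 + k) + (k * f k + (suc (length w) ∸ k) * f (2 + k)) ∎
  where
  k = afterFall y w
  rearrange : ∀ a b c l → a + (b + (c + l * a)) ≡ b + (c + (1 + l) * a)
  rearrange = solve-∀

total-afterRise-insertions f {z} x [] (x<z ∷ _) =
  trans (cong (λ k → f 1 + (f k + 0)) (afterRise-< [] x<z)) (rearrange (f 0) (f 1))
  where
  rearrange : ∀ a b → b + (a + 0) ≡ a + 0 + (b + 0)
  rearrange = solve-∀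
total-afterRise-insertions f {z} x (y ∷ w) (x<z ∷ y<z ∷ w<z) with x <? y
... | yes x<y = begin
  f (2 + k) + total (f ∘ afterRise x) (insertions z (y ∷ w))
    ≡⟨ cong (f (2 + k) +_) (total-insertions-∷ (f ∘ afterRise x) (f ∘ afterRise y) z y w
         (λ v → cong f (afterRise-< v x<y))) ⟩
  f (2 + k) + (f (afterRise x (z ∷ y ∷ w)) + total (f ∘ afterRise y) (insertions z w))
    ≡⟨ cong (λ l → f (2 + k) + (f l + total (f ∘ afterRise y) (insertions z w)))
         (afterRise-max w x<z y<z) ⟩
  f (2 + k) + (f (1 + afterFall y w) + total (f ∘ afterRise y) (insertions z w))
    ≡⟨ cong (f (2 + k) +_) (total-afterRise-insertions f y w (y<z ∷ w<z)) ⟩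
  f (2 + k) + ((1 + k) * f k + (f (1 + k) + (length w ∸ k) * f (2 + k)))
    ≡⟨ rearrange (f (2 + k)) ((1 + k) * f k) (f (1 + k)) (length w ∸ k) ⟩
  (1 + k) * f k + (f (1 + k) + suc (length w ∸ k) * f (2 + k))
    ≡⟨ cong (λ l → (1 + k) * f k + (f (1 + k) + l * f (2 + k))) (+-∸-assoc 1 (afterRise≤length y w)) ⟨
  (1 + k) * f k + (f (1 + k) + (suc (length w) ∸ k) * f (2 + k)) ∎
  where
  k = afterRise y w
  rearrange : ∀ a b c l → a + (b + (c + l * a)) ≡ b + (c + (1 + l) * a)
  rearrange = solve-∀
... | no x≮y = begin
  f (1 + k) + total (f ∘ afterRise x) (insertions z (y ∷ w))
    ≡⟨ cong (f (1 + k) +_) (total-insertions-∷ (f ∘ afterRise x) (f ∘ suc ∘ afterFall y) z y w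
         (λ v → cong f (afterRise-≮ v x≮y))) ⟩
  f (1 + k) + (f (afterRise x (z ∷ y ∷ w)) + total (f ∘ suc ∘ afterFall y) (insertions z w))
    ≡⟨ cong₂ (λ l t → f (1 + k) + (f l + t)) (afterRise-max w x<z y<z)
         (total-afterFall-insertions (f ∘ suc) y w (y<z ∷ w<z)) ⟩
  f (1 + k) + (f (1 + k) + (f (2 + k) + (k * f (1 + k) + (length w ∸ k) * f (3 + k))))
    ≡⟨ rearrange (f (1 + k)) (f (2 + k)) k ((length w ∸ k) * f (3 + k)) ⟩
  (2 + k) * f (1 + k) + (f (2 + k) + (length w ∸ k) * f (3 + k)) ∎
  where
  k = afterFall y w
  rearrange : ∀ a b k c → a + (a + (b + (k * a + c))) ≡ (2 + k) * a + (b + c)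
  rearrange = solve-∀

-- Sums over all permutations as iterated derivatives

letters<1+n : ∀ n {π} → π ∈ 𝔖 n → All (_< suc n) π
letters<1+n n π∈ = All.map (s≤s ∘ proj₂ ∘ ∈-to⁻) (IsPermutation.letters (∈𝔖⁻ {n} π∈))

∈𝔖⇒length : ∀ n {π} → π ∈ 𝔖 n → length π ≡ n
∈𝔖⇒length n π∈ = IsPermutation.length≡ (∈𝔖⁻ {n} π∈)

-- `F m π` will be the m-th derivative of the monomial of `π`, so that `step` trades an insertion
-- for a derivative. The start b is 0 where the empty word has a monomial, namely w or x; it is 1
-- for runs and interior peaks, where the empty word would need y to the power -1.
total-𝔖-iterate : ∀ (F : ℕ → Word → ℕ) b →
  (∀ m {n π} → b ≤ n → π ∈ 𝔖 n → total (F m) (insertions (suc n) π) ≡ F (suc m) π) →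
  ∀ n m → total (F m) (𝔖 (n + b)) ≡ total (F (n + m)) (𝔖 b)
total-𝔖-iterate F b step zero    m = refl
total-𝔖-iterate F b step (suc n) m = begin
  total (F m) (𝔖 (suc (n + b)))
    ≡⟨ total-𝔖-suc (F m) (n + b) ⟩
  total (λ π → total (F m) (insertions (suc (n + b)) π)) (𝔖 (n + b))
    ≡⟨ total-cong (𝔖 (n + b)) (step m (m≤n+m b n)) ⟩
  total (F (suc m)) (𝔖 (n + b))
    ≡⟨ total-𝔖-iterate F b step n (suc m) ⟩
  total (F (n + suc m)) (𝔖 b)
    ≡⟨ cong (λ l → total (F l) (𝔖 b)) (+-suc n m) ⟩
  total (F (suc (n + m))) (𝔖 b) ∎

-- The exponent of y involves the length, whereas the insertion formulas admit only functions of the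
-- statistic. All insertions into `π` have the same length, so it can be fixed beforehand.
total-insertions-length : ∀ (f : ℕ → ℕ → ℕ) (s : Word → ℕ) n {π} → π ∈ 𝔖 n →
  total (λ v → f (length v) (s v)) (insertions (suc n) π) ≡
  total (f (suc n) ∘ s) (insertions (suc n) π)
total-insertions-length f s n {π} π∈ = total-cong (insertions (suc n) π) λ {v} v∈ →
  cong (λ l → f l (s v)) (trans (↭-length (insertions⇒↭ (suc n) π v∈)) (cong suc (∈𝔖⇒length n π∈)))

total-afterFall-𝔖 : ∀ n φ → total (φ ∘ afterFall 0) (𝔖 n) ≡ 𝒟 n 1 0 0 φ
total-afterFall-𝔖 n φ = begin
  total (F 0) (𝔖 n)       ≡⟨ cong (λ l → total (F 0) (𝔖 l)) (+-identityʳ n) ⟨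
  total (F 0) (𝔖 (n + 0)) ≡⟨ total-𝔖-iterate F 0 (λ m _ → step m) n 0 ⟩
  F (n + 0) [] + 0        ≡⟨ +-identityʳ _ ⟩
  F (n + 0) []            ≡⟨ cong (λ l → 𝒟 l 1 0 0 φ) (+-identityʳ n) ⟩
  𝒟 n 1 0 0 φ             ∎
  where
  f : ℕ → ℕ → ℕ → ℕ
  f m l k = 𝒟 m 1 k (l ∸ k) φ
  F : ℕ → Word → ℕ
  F m π = f m (length π) (afterFall 0 π)
  step : ∀ m {n π} → π ∈ 𝔖 n → total (F m) (insertions (suc n) π) ≡ F (suc m) π
  step m {n} {π} π∈ with refl ← ∈𝔖⇒length n π∈ = begin
    total (F m) (insertions (suc n) π)
      ≡⟨ total-insertions-length (f m) (afterFall 0) n π∈ ⟩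
    total (f m (suc n) ∘ afterFall 0) (insertions (suc n) π)
      ≡⟨ total-afterFall-insertions (f m (suc n)) 0 π (z<s ∷ letters<1+n (length π) π∈) ⟩
    f m (suc n) (1 + k) + (k * f m (suc n) k + (n ∸ k) * f m (suc n) (2 + k))
      -- The three terms are the derivatives of w, x and y; they carry y to the powers n - k, n - k
      -- + 1 and n - k - 1.
      ≡⟨ cong₂ _+_ (sym (+-identityʳ (f m (suc n) (1 + k))))
           (cong₂ (λ a b → k * 𝒟 m 1 k a φ + (n ∸ k) * 𝒟 m 1 (2 + k) b φ)
             (+-∸-assoc 1 (afterFall≤length 0 π)) (sym (pred[m∸n]≡m∸[1+n] n k))) ⟩
    F (suc m) π ∎
    where k = afterFall 0 π

halve : ∀ k → (∃ λ p → k ≡ 2 * p × ⌊ k /2⌋ ≡ p × ⌊ suc k /2⌋ ≡ p)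
             ⊎ (∃ λ p → k ≡ 1 + 2 * p × ⌊ k /2⌋ ≡ p × ⌊ suc k /2⌋ ≡ suc p)
halve zero          = inj₁ (0 , refl , refl , refl)
halve (suc zero)    = inj₂ (0 , refl , refl , refl)
halve (suc (suc k)) with halve k
... | inj₁ (p , refl , h , h′) = inj₁ (suc p , sym (*-suc 2 p) , cong suc h , cong suc h′)
... | inj₂ (p , refl , h , h′) = inj₂ (suc p , cong suc (sym (*-suc 2 p)) , cong suc h , cong suc h′)

2*⌊n/2⌋≤n : ∀ n → 2 * ⌊ n /2⌋ ≤ n
2*⌊n/2⌋≤n n with halve n
... | inj₁ (p , refl , h , _) rewrite h = ≤-refl
... | inj₂ (p , refl , h , _) rewrite h = n≤1+n _

-- The only slot whose effect on p depends on parity is the one that raises k by 1: it keeps p for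
-- even k = 2p and raises p for odd k = 2p + 1. In both cases 1 + 2p slots keep p.
halve-transition : ∀ (g : ℕ → ℕ) {k l} → k ≤ l → let p = ⌊ k /2⌋ in
  g ⌊ suc k /2⌋ + (k * g p + (l ∸ k) * g (suc p)) ≡ (1 + 2 * p) * g p + (l ∸ 2 * p) * g (suc p)
halve-transition g {k} {l} k≤l with halve k
... | inj₁ (p , refl , h , h′) rewrite h | h′ = sym (+-assoc (g p) _ _)
... | inj₂ (p , refl , h , h′) rewrite h | h′ =
  trans (rearrange (g (suc p)) _ (l ∸ suc (2 * p)))
        (cong (λ d → (1 + 2 * p) * g p + d * g (suc p)) (sym (+-∸-assoc 1 k≤l)))
  where
  rearrange : ∀ a b d → a + (b + d * a) ≡ b + (1 + d) * a
  rearrange = solve-∀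

total-⌊afterFall/2⌋-insertions : ∀ (g : ℕ → ℕ) {z} x w → All (_< z) (x ∷ w) →
  let p = ⌊ afterFall x w /2⌋ in
  total (g ∘ ⌊_/2⌋ ∘ afterFall x) (insertions z w) ≡
  (1 + 2 * p) * g p + (length w ∸ 2 * p) * g (suc p)
total-⌊afterFall/2⌋-insertions g x w <z =
  trans (total-afterFall-insertions (g ∘ ⌊_/2⌋) x w <z) (halve-transition g (afterFall≤length x w))

2*⌊afterFall/2⌋≤length : ∀ x w → 2 * ⌊ afterFall x w /2⌋ ≤ length w
2*⌊afterFall/2⌋≤length x w = ≤-trans (2*⌊n/2⌋≤n (afterFall x w)) (afterFall≤length x w)

1+n∸2*[1+p] : ∀ n p → suc n ∸ 2 * suc p ≡ pred (n ∸ 2 * p)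
1+n∸2*[1+p] n p = trans (cong (suc n ∸_) (*-suc 2 p)) (sym (pred[m∸n]≡m∸[1+n] n (2 * p)))

total-⌊afterFall/2⌋-𝔖 : ∀ n φ →
  total (λ π → φ (1 + 2 * ⌊ afterFall 0 π /2⌋)) (𝔖 n) ≡ 𝒟 n 0 1 0 φ
total-⌊afterFall/2⌋-𝔖 n φ = begin
  total (F 0) (𝔖 n)       ≡⟨ cong (λ l → total (F 0) (𝔖 l)) (+-identityʳ n) ⟨
  total (F 0) (𝔖 (n + 0)) ≡⟨ total-𝔖-iterate F 0 (λ m _ → step m) n 0 ⟩
  F (n + 0) [] + 0        ≡⟨ +-identityʳ _ ⟩
  F (n + 0) []            ≡⟨ cong (λ l → 𝒟 l 0 1 0 φ) (+-identityʳ n) ⟩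
  𝒟 n 0 1 0 φ             ∎
  where
  g : ℕ → ℕ → ℕ → ℕ
  g m l q = 𝒟 m 0 (1 + 2 * q) (l ∸ 2 * q) φ
  F : ℕ → Word → ℕ
  F m π = g m (length π) ⌊ afterFall 0 π /2⌋
  step : ∀ m {n π} → π ∈ 𝔖 n → total (F m) (insertions (suc n) π) ≡ F (suc m) π
  step m {n} {π} π∈ with refl ← ∈𝔖⇒length n π∈ = begin
    total (F m) (insertions (suc n) π)
      ≡⟨ total-insertions-length (g m) (⌊_/2⌋ ∘ afterFall 0) n π∈ ⟩
    total (g m (suc n) ∘ ⌊_/2⌋ ∘ afterFall 0) (insertions (suc n) π)
      ≡⟨ total-⌊afterFall/2⌋-insertions (g m (suc n)) 0 π (z<s ∷ letters<1+n (length π) π∈) ⟩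
    (1 + 2 * p) * g m (suc n) p + (n ∸ 2 * p) * g m (suc n) (suc p)
      ≡⟨ cong₂ (λ a b → (1 + 2 * p) * a + (n ∸ 2 * p) * b)
           (cong (λ l → 𝒟 m 0 (1 + 2 * p) l φ) (+-∸-assoc 1 (2*⌊afterFall/2⌋≤length 0 π)))
           (cong₂ (λ j l → 𝒟 m 0 (1 + j) l φ) (*-suc 2 p) (1+n∸2*[1+p] n p)) ⟩
    F (suc m) π ∎
    where p = ⌊ afterFall 0 π /2⌋

-- Regarding the first letter as reached by a fall makes the first direction change a valley, so
-- that the peaks are every second change.
peaks : Word → ℕ
peaks []      = 0
peaks (x ∷ w) = ⌊ afterFall x w /2⌋

total-peaks-𝔖 : ∀ n φ → total (λ π → φ (2 + 2 * peaks π)) (𝔖 (suc n)) ≡ 𝒟 n 0 2 0 φ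
total-peaks-𝔖 n φ = begin
  total (F 0) (𝔖 (suc n)) ≡⟨ cong (λ l → total (F 0) (𝔖 l)) (+-comm 1 n) ⟩
  total (F 0) (𝔖 (n + 1)) ≡⟨ total-𝔖-iterate F 1 step n 0 ⟩
  F (n + 0) (1 ∷ []) + 0  ≡⟨ +-identityʳ _ ⟩
  F (n + 0) (1 ∷ [])      ≡⟨ cong (λ l → 𝒟 l 0 2 0 φ) (+-identityʳ n) ⟩
  𝒟 n 0 2 0 φ             ∎
  where
  g : ℕ → ℕ → ℕ → ℕ
  g m l q = 𝒟 m 0 (2 + 2 * q) (pred l ∸ 2 * q) φ
  F : ℕ → Word → ℕ
  F m π = g m (length π) (peaks π)
  step : ∀ m {n π} → 1 ≤ n → π ∈ 𝔖 n → total (F m) (insertions (suc n) π) ≡ F (suc m) π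
  step m {n} {π = []}    1≤n π∈ with refl ← ∈𝔖⇒length n π∈ = contradiction 1≤n λ ()
  step m {n} {π = x ∷ w} 1≤n π∈ with refl ← ∈𝔖⇒length n π∈ | x<z ∷ w<z ← letters<1+n n π∈ = begin
    total (F m) (insertions (suc n) (x ∷ w))
      ≡⟨ total-insertions-length (g m) peaks n π∈ ⟩
    total (g m (suc n) ∘ peaks) (insertions (suc n) (x ∷ w))
      ≡⟨ total-insertions-∷ (g m (suc n) ∘ peaks) (g m (suc n) ∘ ⌊_/2⌋ ∘ afterFall x)
           (suc n) x w (λ _ → refl) ⟩
    g m (suc n) ⌊ afterFall (suc n) (x ∷ w) /2⌋
      + total (g m (suc n) ∘ ⌊_/2⌋ ∘ afterFall x) (insertions (suc n) w)
      -- A largest letter in front only starts a fall and creates no interior peak; this additional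
      -- slot turns the coefficient `1 + 2 * p` into `2 + 2 * p`.
      ≡⟨ cong₂ (λ k t → g m (suc n) ⌊ k /2⌋ + t) (afterFall-≮ w (<-asym x<z))
           (total-⌊afterFall/2⌋-insertions (g m (suc n)) x w (x<z ∷ w<z)) ⟩
    g m (suc n) p + ((1 + 2 * p) * g m (suc n) p + (length w ∸ 2 * p) * g m (suc n) (suc p))
      ≡⟨ +-assoc (g m (suc n) p) _ _ ⟨
    (2 + 2 * p) * g m (suc n) p + (length w ∸ 2 * p) * g m (suc n) (suc p)
      ≡⟨ cong₂ (λ a b → (2 + 2 * p) * a + (length w ∸ 2 * p) * b)
           (cong (λ l → 𝒟 m 0 (2 + 2 * p) l φ) (+-∸-assoc 1 (2*⌊afterFall/2⌋≤length x w)))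
           (cong₂ (λ j l → 𝒟 m 0 (2 + j) l φ) (*-suc 2 p) (1+n∸2*[1+p] (length w) p)) ⟩
    F (suc m) (x ∷ w) ∎
    where p = ⌊ afterFall x w /2⌋

-- On words of length 1 the value 0 matches the convention R 1 = 𝟙.
runs : Word → ℕ
runs []          = 0
runs (x ∷ [])    = 0
runs (x ∷ y ∷ w) with x <? y
... | yes _ = suc (afterRise y w)
... | no  _ = suc (afterFall y w)

runs-< : ∀ {x y} w → x < y → runs (x ∷ y ∷ w) ≡ suc (afterRise y w)
runs-< {x} {y} w x<y with x <? y
... | yes _   = refl
... | no  x≮y = contradiction x<y x≮y

runs-≮ : ∀ {x y} w → ¬ x < y → runs (x ∷ y ∷ w) ≡ suc (afterFall y w)
runs-≮ {x} {y} w x≮y with x <? y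
... | yes x<y = contradiction x<y x≮y
... | no  _   = refl

runs<length : ∀ x w → runs (x ∷ w) ≤ length w
runs<length x []      = z≤n
runs<length x (y ∷ w) with x <? y
... | yes _ = s≤s (afterRise≤length y w)
... | no  _ = s≤s (afterFall≤length y w)

-- At each end of the word one slot, the outermost or its neighbour, adds exactly one run; hence the
-- 2 and the exponent 2 of w. For `as` the prepended 0 leaves only the right end, hence the exponent
-- 1.
total-runs-insertions : ∀ (f : ℕ → ℕ) {z} x w → All (_< z) (x ∷ w) →
  let k = runs (x ∷ w) in
  total (f ∘ runs) (insertions z (x ∷ w)) ≡
  2 * f (1 + k) + (k * f k + (length w ∸ k) * f (2 + k))
total-runs-insertions f {z} x [] (x<z ∷ _) =
  trans (cong₂ (λ a b → f a + (f b + 0)) (runs-≮ [] (<-asym x<z)) (runs-< [] x<z))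
        (sym (+-identityʳ _))
total-runs-insertions f {z} x (y ∷ w) (x<z ∷ y<z ∷ w<z) = begin
  total (f ∘ runs) (insertions z (x ∷ y ∷ w))
    ≡⟨ total-insertions-∷ (f ∘ runs) (f ∘ runs ∘ (x ∷_)) z x (y ∷ w) (λ _ → refl) ⟩
  f (runs (z ∷ x ∷ y ∷ w)) + total (f ∘ runs ∘ (x ∷_)) (insertions z (y ∷ w))
    ≡⟨ cong₂ (λ k t → f k + t) (runs-≮ (y ∷ w) (<-asym x<z))
         (total-insertions-∷ (f ∘ runs ∘ (x ∷_)) (λ v → f (runs (x ∷ y ∷ v))) z y w (λ _ → refl)) ⟩
  f (1 + afterFall x (y ∷ w)) + (f (runs (x ∷ z ∷ y ∷ w)) + deeper)
    ≡⟨ cong (λ k → f (1 + afterFall x (y ∷ w)) + (f k + deeper))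
         (trans (runs-< (y ∷ w) x<z) (cong suc (afterRise-≮ w (<-asym y<z)))) ⟩
  f (1 + afterFall x (y ∷ w)) + (f (2 + afterFall y w) + deeper)
    ≡⟨ rest ⟩
  2 * f (1 + r) + (r * f r + (suc (length w) ∸ r) * f (2 + r)) ∎
  where
  r = runs (x ∷ y ∷ w)
  deeper = total (λ v → f (runs (x ∷ y ∷ v))) (insertions z w)
  rest : f (1 + afterFall x (y ∷ w)) + (f (2 + afterFall y w) + deeper)
       ≡ 2 * f (1 + r) + (r * f r + (suc (length w) ∸ r) * f (2 + r))
  rest with x <? y
  ... | yes x<y = trans
    -- The slot between `x` and `y` is the extra summand of the formula after a rise; the slot in
    -- front gives the second copy of `f (1 + r)`.
    (cong (f (2 + k) +_) (total-afterRise-insertions (f ∘ suc) y w (y<z ∷ w<z)))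
    (rearrange (f (2 + k)) ((1 + k) * f (1 + k)) ((length w ∸ k) * f (3 + k)))
    where
    k = afterRise y w
    rearrange : ∀ a b c → a + (b + (a + c)) ≡ 2 * a + (b + c)
    rearrange = solve-∀
  ... | no x≮y = trans
    -- In front of a fall `z` merely prolongs it: this slot keeps r and raises the coefficient of
    -- `f r` from k to r = 1 + k.
    (cong (λ t → f (1 + k) + (f (2 + k) + t)) (total-afterFall-insertions (f ∘ suc) y w (y<z ∷ w<z)))
    (rearrange (f (1 + k)) (f (2 + k)) k ((length w ∸ k) * f (3 + k)))
    where
    k = afterFall y w
    rearrange : ∀ b a k c → b + (a + (a + (k * b + c))) ≡ 2 * a + ((1 + k) * b + c)
    rearrange = solve-∀

total-runs-𝔖 : ∀ n φ → total (φ ∘ runs) (𝔖 (suc n)) ≡ 𝒟 n 2 0 0 φ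
total-runs-𝔖 n φ = begin
  total (F 0) (𝔖 (suc n)) ≡⟨ cong (λ l → total (F 0) (𝔖 l)) (+-comm 1 n) ⟩
  total (F 0) (𝔖 (n + 1)) ≡⟨ total-𝔖-iterate F 1 step n 0 ⟩
  F (n + 0) (1 ∷ []) + 0  ≡⟨ +-identityʳ _ ⟩
  F (n + 0) (1 ∷ [])      ≡⟨ cong (λ l → 𝒟 l 2 0 0 φ) (+-identityʳ n) ⟩
  𝒟 n 2 0 0 φ             ∎
  where
  f : ℕ → ℕ → ℕ → ℕ
  f m l k = 𝒟 m 2 k (pred l ∸ k) φ
  F : ℕ → Word → ℕ
  F m π = f m (length π) (runs π)
  step : ∀ m {n π} → 1 ≤ n → π ∈ 𝔖 n → total (F m) (insertions (suc n) π) ≡ F (suc m) π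
  step m {n} {π = []}    1≤n π∈ with refl ← ∈𝔖⇒length n π∈ = contradiction 1≤n λ ()
  step m {n} {π = x ∷ w} 1≤n π∈ with refl ← ∈𝔖⇒length n π∈ = begin
    total (F m) (insertions (suc n) (x ∷ w))
      ≡⟨ total-insertions-length (f m) runs n π∈ ⟩
    total (f m (suc n) ∘ runs) (insertions (suc n) (x ∷ w))
      ≡⟨ total-runs-insertions (f m (suc n)) x w (letters<1+n (length (x ∷ w)) π∈) ⟩
    2 * f m (suc n) (1 + k) + (k * f m (suc n) k + (length w ∸ k) * f m (suc n) (2 + k))
      ≡⟨ cong (2 * f m (suc n) (1 + k) +_)
           (cong₂ (λ a b → k * 𝒟 m 2 k a φ + (length w ∸ k) * 𝒟 m 2 (2 + k) b φ)
             (+-∸-assoc 1 (runs<length x w)) (sym (pred[m∸n]≡m∸[1+n] (length w) k))) ⟩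
    F (suc m) (x ∷ w) ∎
    where k = runs (x ∷ w)

-- The statistics as numbers of direction changes

∈-subsequences-∷ : ∀ {v} y w → v ∈ subsequences (y ∷ w) →
  v ∈ subsequences w ⊎ (∃ λ v′ → v′ ∈ subsequences w × v ≡ y ∷ v′)
∈-subsequences-∷ y w v∈ with ∈-++⁻ (subsequences w) v∈
... | inj₁ v∈w = inj₁ v∈w
... | inj₂ v∈map = inj₂ (∈-map⁻ (y ∷_) v∈map)

subsequences-tail : ∀ {y v} w → y ∷ v ∈ subsequences w → v ∈ subsequences w
subsequences-tail []      (here ())
subsequences-tail []      (there ())
subsequences-tail (x ∷ w) yv∈ with ∈-subsequences-∷ x w yv∈
... | inj₁ yv∈w             = ∈-++⁺ˡ (subsequences-tail w yv∈w)
... | inj₂ (_ , v∈w , refl) = ∈-++⁺ˡ v∈w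

subsequences-All : ∀ {P : Pred ℕ 0ℓ} {v w} → v ∈ subsequences w → All P w → All P v
subsequences-All {w = []}    (here refl) []         = []
subsequences-All {w = x ∷ w} v∈          (px ∷ pw) with ∈-subsequences-∷ x w v∈
... | inj₁ v∈w              = subsequences-All v∈w pw
... | inj₂ (_ , v∈w , refl) = px ∷ subsequences-All v∈w pw

falling-raise : ∀ {x y} v → x ≤ y → Falling (x ∷ v) → Falling (y ∷ v)
falling-raise []      x≤y _           = tt
falling-raise (_ ∷ _) x≤y (x>u , ris) = <-≤-trans x>u x≤y , ris

rising-lower : ∀ {x y} v → x ≤ y → Rising (y ∷ v) → Rising (x ∷ v)
rising-lower []      x≤y _           = tt
rising-lower (_ ∷ _) x≤y (y<u , fal) = ≤-<-trans x≤y y<u , fal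

afterFall≤1+afterRise : ∀ x w → afterFall x w ≤ suc (afterRise x w)
afterFall≤1+afterRise x []      = z≤n
afterFall≤1+afterRise x (y ∷ w) with x <? y
... | yes _ = ≤-refl
... | no  _ = m≤n⇒m≤1+n (n≤1+n _)

afterRise≤1+afterFall : ∀ x w → afterRise x w ≤ suc (afterFall x w)
afterRise≤1+afterFall x []      = z≤n
afterRise≤1+afterFall x (y ∷ w) with x <? y
... | yes _ = m≤n⇒m≤1+n (n≤1+n _)
... | no  _ = ≤-refl

-- Exchange argument. If the direction does not turn at `x`, then `y` may replace `x`. If it turns
-- and `v` skips `y`, then `y` may replace the first letter u of `v` when it is at least as extreme
-- as u; otherwise `v` already continues from `y` in the same sense, and the two counts at `y`
-- differ by at most one.
rising-length : ∀ x w v → v ∈ subsequences w → Rising (x ∷ v) → length v ≤ afterFall x w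
falling-length : ∀ x w v → v ∈ subsequences w → Falling (x ∷ v) → length v ≤ afterRise x w
rising-length x []      v (here refl) _   = z≤n
rising-length x (y ∷ w) v v∈          ris with ∈-subsequences-∷ y w v∈
... | inj₂ (v′ , v′∈ , refl) with x<y , fal ← ris rewrite afterFall-< w x<y =
  s≤s (falling-length y w v′ v′∈ fal)
... | inj₁ v∈w with x <? y
...   | no x≮y = rising-length y w v v∈w (rising-lower v (≮⇒≥ x≮y) ris)
...   | yes _ with v
...     | [] = z≤n
...     | u ∷ v′ with u ≤? y
...       | yes u≤y = s≤s (falling-length y w v′ (subsequences-tail w v∈w) (falling-raise v′ u≤y (proj₂ ris)))
...       | no  u≰y = ≤-trans (rising-length y w (u ∷ v′) v∈w (≰⇒> u≰y , proj₂ ris))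
                              (afterFall≤1+afterRise y w)
falling-length x []      v (here refl) _   = z≤n
falling-length x (y ∷ w) v v∈          fal with ∈-subsequences-∷ y w v∈
... | inj₂ (v′ , v′∈ , refl) with y<x , ris ← fal rewrite afterRise-≮ w (<-asym y<x) =
  s≤s (rising-length y w v′ v′∈ ris)
... | inj₁ v∈w with x <? y
...   | yes x<y = falling-length y w v v∈w (falling-raise v (<⇒≤ x<y) fal)
...   | no _ with v
...     | [] = z≤n
...     | u ∷ v′ with y ≤? u
...       | yes y≤u = s≤s (rising-length y w v′ (subsequences-tail w v∈w) (rising-lower v′ y≤u (proj₂ fal)))
...       | no  y≰u = ≤-trans (falling-length y w (u ∷ v′) v∈w (≰⇒> y≰u , proj₂ fal))
                              (afterRise≤1+afterFall y w)

-- The witness consists of the letters where the direction turns and of the last letter. Its head h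
-- need not be `x`, as the run through `x` may go on; the comparison of h with `x` is what allows an
-- earlier letter to be put in front.
longest-rising : ∀ x w → Unique (x ∷ w) → ∃₂ λ h t →
  h ∷ t ∈ subsequences (x ∷ w) × length t ≡ afterFall x w × h ≤ x × Rising (h ∷ t)
longest-falling : ∀ x w → Unique (x ∷ w) → ∃₂ λ h t →
  h ∷ t ∈ subsequences (x ∷ w) × length t ≡ afterRise x w × x ≤ h × Falling (h ∷ t)
longest-rising x []      _ = x , [] , there (here refl) , refl , ≤-refl , tt
longest-rising x (y ∷ w) (_ ∷ u) with x <? y
... | yes x<y with h , t , ht∈ , len , y≤h , fal ← longest-falling y w u =
  x , h ∷ t , ∈-++⁺ʳ (subsequences (y ∷ w)) (∈-map⁺ (x ∷_) ht∈) , cong suc len , ≤-refl ,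
  <-≤-trans x<y y≤h , fal
... | no x≮y with h , t , ht∈ , len , h≤y , ris ← longest-rising y w u =
  h , t , ∈-++⁺ˡ ht∈ , len , ≤-trans h≤y (≮⇒≥ x≮y) , ris
longest-falling x []      _ = x , [] , there (here refl) , refl , ≤-refl , tt
longest-falling x (y ∷ w) ((x≢y ∷ _) ∷ u) with x <? y
... | yes x<y with h , t , ht∈ , len , y≤h , fal ← longest-falling y w u =
  h , t , ∈-++⁺ˡ ht∈ , len , ≤-trans (<⇒≤ x<y) y≤h , fal
... | no x≮y with h , t , ht∈ , len , h≤y , ris ← longest-rising y w u =
  x , h ∷ t , ∈-++⁺ʳ (subsequences (y ∷ w)) (∈-map⁺ (x ∷_) ht∈) , cong suc len , ≤-refl ,
  ≤-<-trans h≤y (≤∧≢⇒< (≮⇒≥ x≮y) (≢-sym x≢y)) , ris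

as≡afterFall : ∀ π → Unique π → All (0 <_) π → as π ≡ afterFall 0 π
as≡afterFall π u pos = ≤-antisym upper (lower π u pos)
  where
  bound : ∀ v → v ∈ subsequences π → Falling v → length v ≤ afterFall 0 π
  bound []      _  _   = z≤n
  -- Positivity of the letters allows 0 to be put in front of a falling subsequence, which then
  -- rises from 0.
  bound (y ∷ v) v∈ fal with 0<y ∷ _ ← subsequences-All v∈ pos =
    rising-length 0 π (y ∷ v) v∈ (0<y , fal)
  bounds : ∀ {k} → k ∈ map length (filter falling? (subsequences π)) → k ≤ afterFall 0 π
  bounds k∈ with v , v∈f , refl ← ∈-map⁻ length k∈
            with v∈ , fal ← ∈-filter⁻ falling? {xs = subsequences π} v∈f = bound v v∈ fal
  upper : as π ≤ afterFall 0 π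
  upper = max≤v⁺ {xs = map length (filter falling? (subsequences π))} z≤n (All.tabulate bounds)
  lower : ∀ π → Unique π → All (0 <_) π → afterFall 0 π ≤ as π
  lower []      _ _         = z≤n
  lower (y ∷ w) u (0<y ∷ _) with h , t , ht∈ , len , _ , fal ← longest-falling y w u =
    v≤max⁺ 0 (map length (filter falling? (subsequences (y ∷ w))))
      (inj₂ (lose (∈-map⁺ length (∈-filter⁺ falling? ht∈ fal))
        (≤-reflexive (trans (afterFall-< w 0<y) (cong suc (sym len))))))

-- Peaks and direction changes: from positions to recursion on the word

length-filter : {P : Pred A 0ℓ} (P? : Decidable P) (xs : List A) →
                length (filter P? xs) ≡ total (λ x → ⟨ P? x ⟩?) xs
length-filter P? []       = refl
length-filter P? (x ∷ xs) = trans (length-filter-∷ P? x xs) (cong (⟨ P? x ⟩? +_) (length-filter P? xs))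

countTriples : (ℕ → ℕ → ℕ → ℕ) → Word → ℕ
countTriples f (a ∷ b ∷ c ∷ w) = f a b c + countTriples f (b ∷ c ∷ w)
countTriples f _               = 0

-- The indices have the shape to which the letters at i - 1, i and i + 1 reduce when i is counted
-- from 2, or from 1 in the word with 0 prepended.
sum<-triples : ∀ f w →
  sum< (length w ∸ 2) (λ i → f (coeff w i) (coeff w (suc i)) (coeff w (suc (i + 1)))) ≡
  countTriples f w
sum<-triples f []              = refl
sum<-triples f (a ∷ [])        = refl
sum<-triples f (a ∷ b ∷ [])    = refl
sum<-triples f (a ∷ b ∷ c ∷ w) = cong (f a b c +_) (sum<-triples f (b ∷ c ∷ w))

peak? : ∀ a b c → Dec (a < b × b > c)
peak? a b c = (a <? b) ×-dec (b >? c)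

valley? : ∀ a b c → Dec (a > b × b < c)
valley? a b c = (a >? b) ×-dec (b <? c)

turn? : ∀ a b c → Dec (a < b × b > c ⊎ a > b × b < c)
turn? a b c = peak? a b c ⊎-dec valley? a b c

peak turn : ℕ → ℕ → ℕ → ℕ
peak a b c = ⟨ peak? a b c ⟩?
turn a b c = ⟨ turn? a b c ⟩?

1+[n∸1]∸2 : ∀ n → suc (n ∸ 1) ∸ 2 ≡ n ∸ 2
1+[n∸1]∸2 zero    = refl
1+[n∸1]∸2 (suc n) = refl

leftPeaks≡countTriples : ∀ π → leftPeaks π ≡ countTriples peak (0 ∷ π)
leftPeaks≡countTriples π = trans (length-filter (isPeak? π) (1 to (length π ∸ 1)))
  (trans (total-to (λ i → ⟨ isPeak? π i ⟩?) 1 (length π ∸ 1)) (sum<-triples peak (0 ∷ π)))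

interiorPeaks≡countTriples : ∀ π → interiorPeaks π ≡ countTriples peak π
interiorPeaks≡countTriples π = trans (length-filter (isPeak? π) (2 to (length π ∸ 1)))
  (trans (total-to (λ i → ⟨ isPeak? π i ⟩?) 2 (length π ∸ 1))
    (trans (cong (λ l → sum< l (λ i → ⟨ isPeak? π (2 + i) ⟩?)) (1+[n∸1]∸2 (length π)))
           (sum<-triples peak π)))

directionChanges≡countTriples : ∀ π → directionChanges π ≡ countTriples turn π
directionChanges≡countTriples π = trans (length-filter (changesDirection? π) (2 to (length π ∸ 1)))
  (trans (total-to (λ i → ⟨ changesDirection? π i ⟩?) 2 (length π ∸ 1))
    (trans (cong (λ l → sum< l (λ i → ⟨ changesDirection? π (2 + i) ⟩?)) (1+[n∸1]∸2 (length π)))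
           (sum<-triples turn π)))

-- The recursion restarts at `y` as if a fall had led there. On a rise `x < y < z` this moves the
-- initial valley from `x` to `y`; at a peak it drops a valley together with the peak, which is one
-- unit of `⌊_/2⌋`.
countTriples-peak : ∀ x y w → Unique (x ∷ y ∷ w) →
  countTriples peak (x ∷ y ∷ w) ≡ ⌊ afterFall x (y ∷ w) /2⌋
countTriples-peak x y [] _ with x <? y
... | yes _ = refl
... | no  _ = refl
countTriples-peak x y (z ∷ w) (_ ∷ u@((y≢z ∷ _) ∷ _)) with x <? y
... | no x≮y = cong₂ _+_ (⟨no⟩ (peak? x y z) (x≮y ∘ proj₁)) (countTriples-peak y z w u)
... | yes x<y with y <? z
...   | yes y<z = cong₂ _+_ (⟨no⟩ (peak? x y z) (<-asym y<z ∘ proj₂))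
                    (trans (countTriples-peak y z w u) (cong ⌊_/2⌋ (afterFall-< w y<z)))
...   | no y≮z = cong₂ _+_ (⟨yes⟩ (peak? x y z) (x<y , ≤∧≢⇒< (≮⇒≥ y≮z) (≢-sym y≢z)))
                   (trans (countTriples-peak y z w u) (cong ⌊_/2⌋ (afterFall-≮ w y≮z)))

countTriples-turn : ∀ x y w → Unique (x ∷ y ∷ w) → suc (countTriples turn (x ∷ y ∷ w)) ≡ runs (x ∷ y ∷ w)
countTriples-turn x y [] _ with x <? y
... | yes _ = refl
... | no  _ = refl
countTriples-turn x y (z ∷ w) ((x≢y ∷ _) ∷ u@((y≢z ∷ _) ∷ _)) with x <? y
... | yes x<y with y <? z
...   | yes y<z = cong₂ (λ a b → suc (a + b))
  (⟨no⟩ (turn? x y z) λ { (inj₁ (_ , z<y)) → <-asym y<z z<y ; (inj₂ (y<x , _)) → <-asym x<y y<x })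
  (suc-injective (trans (countTriples-turn y z w u) (runs-< w y<z)))
...   | no y≮z = cong₂ (λ a b → suc (a + b))
  (⟨yes⟩ (turn? x y z) (inj₁ (x<y , ≤∧≢⇒< (≮⇒≥ y≮z) (≢-sym y≢z))))
  (suc-injective (trans (countTriples-turn y z w u) (runs-≮ w y≮z)))
countTriples-turn x y (z ∷ w) ((x≢y ∷ _) ∷ u@((y≢z ∷ _) ∷ _)) | no x≮y with y <? z
...   | yes y<z = cong₂ (λ a b → suc (a + b))
  (⟨yes⟩ (turn? x y z) (inj₂ (≤∧≢⇒< (≮⇒≥ x≮y) (≢-sym x≢y) , y<z)))
  (suc-injective (trans (countTriples-turn y z w u) (runs-< w y<z)))
...   | no y≮z = cong₂ (λ a b → suc (a + b))
  (⟨no⟩ (turn? x y z) λ { (inj₁ (x<y , _)) → x≮y x<y ; (inj₂ (_ , y<z)) → y≮z y<z })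
  (suc-injective (trans (countTriples-turn y z w u) (runs-≮ w y≮z)))

-- Generating polynomials as derivatives

module _ (n : ℕ) {π : Word} (π∈ : π ∈ 𝔖 n) where

  𝔖⇒unique : Unique π
  𝔖⇒unique = IsPermutation.unique (∈𝔖⁻ {n} π∈)

  𝔖⇒positive : All (0 <_) π
  𝔖⇒positive = All.map (proj₁ ∘ ∈-to⁻) (IsPermutation.letters (∈𝔖⁻ {n} π∈))

  as-𝔖 : as π ≡ afterFall 0 π
  as-𝔖 = as≡afterFall π 𝔖⇒unique 𝔖⇒positive

  leftPeaks-𝔖 : leftPeaks π ≡ ⌊ afterFall 0 π /2⌋
  leftPeaks-𝔖 = trans (leftPeaks≡countTriples π) (counted π 𝔖⇒unique 𝔖⇒positive)
    where
    counted : ∀ π → Unique π → All (0 <_) π → countTriples peak (0 ∷ π) ≡ ⌊ afterFall 0 π /2⌋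
    counted []      _ _   = refl
    counted (y ∷ w) u pos = countTriples-peak 0 y w (All.map <⇒≢ pos ∷ u)

  interiorPeaks-𝔖 : interiorPeaks π ≡ peaks π
  interiorPeaks-𝔖 = trans (interiorPeaks≡countTriples π) (counted π 𝔖⇒unique)
    where
    counted : ∀ π → Unique π → countTriples peak π ≡ peaks π
    counted []          _ = refl
    counted (x ∷ [])    _ = refl
    counted (x ∷ y ∷ w) u = countTriples-peak x y w u

  leftPeaks≤ : leftPeaks π ≤ n
  leftPeaks≤ = subst₂ _≤_ (sym leftPeaks-𝔖) (∈𝔖⇒length n π∈)
    (≤-trans (⌊n/2⌋≤n _) (afterFall≤length 0 π))

  interiorPeaks≤ : interiorPeaks π ≤ n
  interiorPeaks≤ = subst₂ _≤_ (sym interiorPeaks-𝔖) (∈𝔖⇒length n π∈) (bound π)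
    where
    bound : ∀ π → peaks π ≤ length π
    bound []      = z≤n
    bound (x ∷ w) = ≤-trans (⌊n/2⌋≤n _) (m≤n⇒m≤1+n (afterFall≤length x w))

as-bounds : ∀ n {π} → π ∈ 𝔖 (suc n) → 1 ≤ as π × as π ≤ suc n
as-bounds n {π} π∈ =
  subst (1 ≤_) (sym (as-𝔖 (suc n) π∈)) (positive π (∈𝔖⇒length (suc n) π∈) (𝔖⇒positive (suc n) π∈)) ,
  subst₂ _≤_ (sym (as-𝔖 (suc n) π∈)) (∈𝔖⇒length (suc n) π∈) (afterFall≤length 0 π)
  where
  positive : ∀ π → length π ≡ suc n → All (0 <_) π → 1 ≤ afterFall 0 π
  positive (y ∷ w) _ (0<y ∷ _) = subst (1 ≤_) (sym (afterFall-< w 0<y)) z<s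

runs-𝔖 : ∀ n {π} → π ∈ 𝔖 (2 + n) → suc (directionChanges π) ≡ runs π
runs-𝔖 n {π} π∈ = trans (cong suc (directionChanges≡countTriples π))
  (counted π (∈𝔖⇒length (2 + n) π∈) (𝔖⇒unique (2 + n) π∈))
  where
  counted : ∀ π → length π ≡ 2 + n → Unique π → suc (countTriples turn π) ≡ runs π
  counted (x ∷ [])    ()
  counted (x ∷ y ∷ w) _ u = countTriples-turn x y w u

runs-bounds : ∀ n {π} → π ∈ 𝔖 (2 + n) → 1 ≤ suc (directionChanges π) × suc (directionChanges π) ≤ suc n
runs-bounds n {π} π∈ = z<s ,
  subst (_≤ suc n) (sym (runs-𝔖 n π∈)) (bound π (∈𝔖⇒length (2 + n) π∈))
  where
  bound : ∀ π → length π ≡ 2 + n → runs π ≤ suc n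
  bound (x ∷ w) len = subst (runs (x ∷ w) ≤_) (suc-injective len) (runs<length x w)

⟦𝟙⟧ : ∀ φ → ⟦ 𝟙 ⟧ φ ≡ φ 0
⟦𝟙⟧ = ⟦⟧-X^^ 0

⟦T⟧ : ∀ n φ → ⟦ T n ⟧ φ ≡ 𝒟 n 1 0 0 φ
⟦T⟧ zero      φ = ⟦𝟙⟧ φ
⟦T⟧ n@(suc l) φ = begin
  ⟦ T n ⟧ φ                      ≡⟨ ⟦∑distribution⟧ φ as n 1 n (as-bounds l) ⟩
  total (φ ∘ as) (𝔖 n)          ≡⟨ total-cong (𝔖 n) (λ π∈ → cong φ (as-𝔖 n π∈)) ⟩
  total (φ ∘ afterFall 0) (𝔖 n) ≡⟨ total-afterFall-𝔖 n φ ⟩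
  𝒟 n 1 0 0 φ                   ∎

⟦R⟧ : ∀ n φ → ⟦ R (1 + n) ⟧ φ ≡ 𝒟 n 2 0 0 φ
-- The convention for one letter is the value 1 of w²; one more than its number of direction changes
-- would give x instead.
⟦R⟧ zero    φ = ⟦𝟙⟧ φ
⟦R⟧ (suc n) φ = begin
  ⟦ R (2 + n) ⟧ φ
    ≡⟨ ⟦∑distribution⟧ φ (suc ∘ directionChanges) (2 + n) 1 (1 + n) (runs-bounds n) ⟩
  total (φ ∘ suc ∘ directionChanges) (𝔖 (2 + n))
    ≡⟨ total-cong (𝔖 (2 + n)) (λ π∈ → cong φ (runs-𝔖 n π∈)) ⟩
  total (φ ∘ runs) (𝔖 (2 + n))
    ≡⟨ total-runs-𝔖 (suc n) φ ⟩
  𝒟 (suc n) 2 0 0 φ ∎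

⟦W~⟧ : ∀ n φ → ⟦ W~ n ∘ₚ X ^^ 2 ⟧ (λ k → φ (1 + k)) ≡ 𝒟 n 0 1 0 φ
⟦W~⟧ n φ = trans (⟦⟧-∘ₚX² (W~ n) (λ k → φ (1 + k))) (enumerate n)
  where
  enumerate : ∀ n → ⟦ W~ n ⟧ (λ k → φ (1 + 2 * k)) ≡ 𝒟 n 0 1 0 φ
  enumerate zero      = ⟦𝟙⟧ (λ k → φ (1 + 2 * k))
  enumerate n@(suc _) = begin
    ⟦ W~ n ⟧ (λ k → φ (1 + 2 * k))
      ≡⟨ ⟦∑distribution⟧ (λ k → φ (1 + 2 * k)) leftPeaks n 0 n (λ π∈ → z≤n , leftPeaks≤ n π∈) ⟩
    total (λ π → φ (1 + 2 * leftPeaks π)) (𝔖 n)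
      ≡⟨ total-cong (𝔖 n) (λ π∈ → cong (λ k → φ (1 + 2 * k)) (leftPeaks-𝔖 n π∈)) ⟩
    total (λ π → φ (1 + 2 * ⌊ afterFall 0 π /2⌋)) (𝔖 n)
      ≡⟨ total-⌊afterFall/2⌋-𝔖 n φ ⟩
    𝒟 n 0 1 0 φ ∎

-- Interior peaks start from the one-letter word, whose monomial x² is already D y; the
-- undifferentiated y corresponds to no permutation.
⟦W⟧ : ∀ n φ → ⟦ W (suc n) ∘ₚ X ^^ 2 ⟧ (λ k → φ (2 + k)) ≡ 𝒟 (suc n) 0 0 1 φ
⟦W⟧ l φ = begin
  ⟦ W n ∘ₚ X ^^ 2 ⟧ (λ k → φ (2 + k))
    ≡⟨ ⟦⟧-∘ₚX² (W n) (λ k → φ (2 + k)) ⟩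
  ⟦ W n ⟧ (λ k → φ (2 + 2 * k))
    ≡⟨ ⟦∑distribution⟧ (λ k → φ (2 + 2 * k)) interiorPeaks n 0 n (λ π∈ → z≤n , interiorPeaks≤ n π∈) ⟩
  total (λ π → φ (2 + 2 * interiorPeaks π)) (𝔖 n)
    ≡⟨ total-cong (𝔖 n) (λ π∈ → cong (λ k → φ (2 + 2 * k)) (interiorPeaks-𝔖 n π∈)) ⟩
  total (λ π → φ (2 + 2 * peaks π)) (𝔖 n)
    ≡⟨ total-peaks-𝔖 l φ ⟩
  𝒟 l 0 2 0 φ
    ≡⟨ +-identityʳ _ ⟨
  𝒟 n 0 0 1 φ ∎
  where n = suc l

-- The power of x in front of an identity is moved into the second factor, because the peak
-- polynomials are derivatives only after multiplication by x or x². Where no such power occurs, s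
-- is 0.
⟦⊗⟧-𝒟 : ∀ p q s a b {i j m i′ j′ m′} φ →
  (∀ ψ → ⟦ p ⟧ ψ ≡ 𝒟 a i j m ψ) → (∀ ψ → ⟦ q ⟧ (λ k → ψ (s + k)) ≡ 𝒟 b i′ j′ m′ ψ) →
  ⟦ p ⊗ q ⟧ (λ k → φ (s + k)) ≡ 𝒟-product i j m i′ j′ m′ φ a b
⟦⊗⟧-𝒟 p q s a b {i} {j} {m} {i′} {j′} {m′} φ ⟦p⟧ ⟦q⟧ = begin
  ⟦ p ⊗ q ⟧ (λ k → φ (s + k))
    ≡⟨ ⟦⟧-⊗ p q (λ k → φ (s + k)) ⟩
  ⟦ p ⟧ (λ x → ⟦ q ⟧ (λ y → φ (s + (x + y))))
    ≡⟨ ⟦⟧-cong p (λ x → ⟦⟧-cong q (λ y → cong φ (x∙yz≈y∙xz s x y))) ⟩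
  ⟦ p ⟧ (λ x → ⟦ q ⟧ (λ y → φ (x + (s + y))))
    ≡⟨ ⟦p⟧ (λ x → ⟦ q ⟧ (λ y → φ (x + (s + y)))) ⟩
  𝒟 a i j m (λ x → ⟦ q ⟧ (λ y → φ (x + (s + y))))
    ≡⟨ 𝒟-cong a i j m (λ x → ⟦q⟧ (λ y → φ (x + y))) ⟩
  𝒟-product i j m i′ j′ m′ φ a b ∎

-- The limit l is kept apart from n because the sum in the last identity stops at n - 1.
⟦∑C⟧ : ∀ n l (f : ℕ → Poly) φ →
  ⟦ ∑[ k ∈ 0 to l ] ((n C k) · f k) ⟧ φ ≡ sum< (suc l) (λ k → (n C k) * ⟦ f k ⟧ φ)
⟦∑C⟧ n l f φ = begin
  ⟦ ∑[ k ∈ 0 to l ] ((n C k) · f k) ⟧ φ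
    ≡⟨ ⟦⟧-∑ (0 to l) (λ k → (n C k) · f k) φ ⟩
  total (λ k → ⟦ (n C k) · f k ⟧ φ) (0 to l)
    ≡⟨ total-to (λ k → ⟦ (n C k) · f k ⟧ φ) 0 l ⟩
  sum< (suc l) (λ k → ⟦ (n C k) · f k ⟧ φ)
    ≡⟨ sum<-cong (suc l) (λ {k} _ → ⟦⟧-· (n C k) (f k) φ) ⟩
  sum< (suc l) (λ k → (n C k) * ⟦ f k ⟧ φ) ∎

⟦∑⊗⟧-𝒟 : ∀ (p q : ℕ → Poly) s n {i j m i′ j′ m′} φ →
  (∀ a ψ → ⟦ p a ⟧ ψ ≡ 𝒟 a i j m ψ) → (∀ b ψ → ⟦ q b ⟧ (λ k → ψ (s + k)) ≡ 𝒟 b i′ j′ m′ ψ) →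
  ⟦ ∑[ k ∈ 0 to n ] ((n C k) · (p k ⊗ q (n ∸ k))) ⟧ (λ k → φ (s + k)) ≡
  𝒟 n (i + i′) (j + j′) (m + m′) φ
⟦∑⊗⟧-𝒟 p q s n {i} {j} {m} {i′} {j′} {m′} φ ⟦p⟧ ⟦q⟧ = begin
  ⟦ ∑[ k ∈ 0 to n ] ((n C k) · (p k ⊗ q (n ∸ k))) ⟧ (λ k → φ (s + k))
    ≡⟨ ⟦∑C⟧ n n (λ k → p k ⊗ q (n ∸ k)) (λ k → φ (s + k)) ⟩
  sum< (suc n) (λ k → (n C k) * ⟦ p k ⊗ q (n ∸ k) ⟧ (λ k → φ (s + k)))
    ≡⟨ sum<-cong (suc n) (λ {k} _ → cong ((n C k) *_)
         (⟦⊗⟧-𝒟 (p k) (q (n ∸ k)) s k (n ∸ k) φ (⟦p⟧ k) (⟦q⟧ (n ∸ k)))) ⟩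
  binom n (𝒟-product i j m i′ j′ m′ φ)
    ≡⟨ leibniz n i j m i′ j′ m′ φ ⟨
  𝒟 n (i + i′) (j + j′) (m + m′) φ ∎

𝒟-w : ∀ n φ → 𝒟 (suc n) 1 0 0 φ ≡ 𝒟 n 1 1 0 φ
𝒟-w n φ = trans (+-identityʳ _) (+-identityʳ _)

𝒟-w² : ∀ n φ → 𝒟 (suc n) 2 0 0 φ ≡ 2 * 𝒟 n 2 1 0 φ
𝒟-w² n φ = +-identityʳ _

-- Both first derivatives are wx² + wxy. At order 0 the values are x and 1, which is why the last
-- identity needs n ≥ 1.
𝒟-wx≡𝒟-wy : ∀ n φ → 𝒟 (suc n) 1 1 0 φ ≡ 𝒟 (suc n) 1 0 1 φ
𝒟-wx≡𝒟-wy n φ = exchange (𝒟 n 1 2 0 φ) (𝒟 n 1 1 1 φ)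
  where
  exchange : ∀ a b → 1 * a + (1 * b + 0) ≡ 1 * b + (0 + 1 * a)
  exchange = solve-∀

T-recurrence : ∀ l φ → let n = suc l in
  𝒟 (suc n) 1 0 0 φ ≡
  𝒟 n 1 0 0 φ + ⟦ ∑[ k ∈ 0 to l ] ((n C k) · (T k ⊗ (W (n ∸ k) ∘ₚ X ^^ 2))) ⟧ (λ k → φ (2 + k))
T-recurrence l φ = begin
  𝒟 (suc n) 1 0 0 φ
    ≡⟨ 𝒟-w n φ ⟩
  𝒟 n 1 1 0 φ
    ≡⟨ 𝒟-wx≡𝒟-wy l φ ⟩
  𝒟 n 1 0 1 φ
    ≡⟨ leibniz n 1 0 0 0 0 1 φ ⟩
  sum< (suc n) (λ k → (n C k) * F k (n ∸ k))
    -- In the summand k = n the letter y is not differentiated and, being 1, leaves Tₙ; in all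
    -- others it is differentiated at least once and gives x² W(x²).
    ≡⟨ sum<-last n (λ k → (n C k) * F k (n ∸ k)) ⟩
  sum< n (λ k → (n C k) * F k (n ∸ k)) + (n C n) * F n (n ∸ n)
    ≡⟨ cong₂ _+_ (sum<-cong n (λ {k} k<n → cong ((n C k) *_) (sym (term k<n)))) last ⟩
  sum< n (λ k → (n C k) * ⟦ T k ⊗ (W (n ∸ k) ∘ₚ X ^^ 2) ⟧ (λ k → φ (2 + k))) + 𝒟 n 1 0 0 φ
    ≡⟨ +-comm _ (𝒟 n 1 0 0 φ) ⟩
  𝒟 n 1 0 0 φ + sum< n (λ k → (n C k) * ⟦ T k ⊗ (W (n ∸ k) ∘ₚ X ^^ 2) ⟧ (λ k → φ (2 + k)))
    ≡⟨ cong (𝒟 n 1 0 0 φ +_) (⟦∑C⟧ n l (λ k → T k ⊗ (W (n ∸ k) ∘ₚ X ^^ 2)) (λ k → φ (2 + k))) ⟨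
  𝒟 n 1 0 0 φ + ⟦ ∑[ k ∈ 0 to l ] ((n C k) · (T k ⊗ (W (n ∸ k) ∘ₚ X ^^ 2))) ⟧ (λ k → φ (2 + k)) ∎
  where
  n = suc l
  F = 𝒟-product 1 0 0 0 0 1 φ
  term : ∀ {k} → k < n → ⟦ T k ⊗ (W (n ∸ k) ∘ₚ X ^^ 2) ⟧ (λ k → φ (2 + k)) ≡ F k (n ∸ k)
  term {k} k<n rewrite +-∸-assoc 1 (≤-pred k<n) =
    ⟦⊗⟧-𝒟 (T k) (W (suc (l ∸ k)) ∘ₚ X ^^ 2) 2 k (suc (l ∸ k)) {i′ = 0} {0} {1} φ (⟦T⟧ k) (⟦W⟧ (l ∸ k))
  last : (n C n) * F n (n ∸ n) ≡ 𝒟 n 1 0 0 φ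
  last = trans (cong₂ (λ c b → c * F n b) (nCn≡1 n) (n∸n≡0 n))
    (trans (+-identityʳ _) (𝒟-cong n 1 0 0 (λ p → cong φ (+-identityʳ p))))

corollary7 : ∀ (n : ℕ) → n ≥ 1 →
    (R (1 + n) ≈ (∑[ k ∈ 0 to n ] ((n C k) · (T k ⊗ T (n ∸ k)))))
    × (R (2 + n) ≈ 2 · (∑[ k ∈ 0 to n ] ((n C k) · (T k ⊗ T (1 + (n ∸ k))))))
    × (R (2 + n) ≈ 2 · X ⊗ (∑[ k ∈ 0 to n ] ((n C k) · (R (1 + k) ⊗ (W~ (n ∸ k) ∘ₚ X ^^ 2)))))
    × (T (1 + n) ≈ X ⊗ (∑[ k ∈ 0 to n ] ((n C k) · (T k ⊗ (W~ (n ∸ k) ∘ₚ X ^^ 2)))))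
    × (T (1 + n) ≈ T n ⊕ X ^^ 2 ⊗ (∑[ k ∈ 0 to (n ∸ 1) ] ((n C k) · (T k ⊗ (W (n ∸ k) ∘ₚ X ^^ 2)))))
corollary7 n@(suc l) _ =
  ⟦⟧⇒≈ (R (1 + n)) ∑TT (λ φ → trans (⟦R⟧ n φ) (sym (⟦∑⊗⟧-𝒟 T T 0 n φ ⟦T⟧ ⟦T⟧))) ,
  R≈ (2 · ∑TT′) (λ φ → trans (⟦⟧-· 2 ∑TT′ φ) (cong (2 *_)
    (⟦∑⊗⟧-𝒟 T (T ∘ suc) 0 n φ ⟦T⟧ (λ b ψ → trans (⟦T⟧ (suc b) ψ) (𝒟-w b ψ))))) ,
  R≈ (2 · X ⊗ ∑RW~) (λ φ → trans (⟦⟧-2X⊗ ∑RW~ φ) (cong (2 *_)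
    (⟦∑⊗⟧-𝒟 (R ∘ suc) (λ m → W~ m ∘ₚ X ^^ 2) 1 n φ ⟦R⟧ ⟦W~⟧))) ,
  ⟦⟧⇒≈ (T (1 + n)) (X ⊗ ∑TW~) (λ φ → trans (trans (⟦T⟧ (1 + n) φ) (𝒟-w n φ)) (sym
    (trans (⟦⟧-X⊗ ∑TW~ φ) (⟦∑⊗⟧-𝒟 T (λ m → W~ m ∘ₚ X ^^ 2) 1 n φ ⟦T⟧ ⟦W~⟧)))) ,
  ⟦⟧⇒≈ (T (1 + n)) (T n ⊕ X ^^ 2 ⊗ ∑TW) (λ φ → trans (trans (⟦T⟧ (1 + n) φ) (T-recurrence l φ)) (sym
    (trans (⟦⟧-⊕ (T n) (X ^^ 2 ⊗ ∑TW) φ) (cong₂ _+_ (⟦T⟧ n φ) (⟦⟧-X²⊗ ∑TW φ)))))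
  where
  ∑TT ∑TT′ ∑RW~ ∑TW~ ∑TW : Poly
  ∑TT  = ∑[ k ∈ 0 to n ] ((n C k) · (T k ⊗ T (n ∸ k)))
  ∑TT′ = ∑[ k ∈ 0 to n ] ((n C k) · (T k ⊗ T (1 + (n ∸ k))))
  ∑RW~ = ∑[ k ∈ 0 to n ] ((n C k) · (R (1 + k) ⊗ (W~ (n ∸ k) ∘ₚ X ^^ 2)))
  ∑TW~ = ∑[ k ∈ 0 to n ] ((n C k) · (T k ⊗ (W~ (n ∸ k) ∘ₚ X ^^ 2)))
  ∑TW  = ∑[ k ∈ 0 to l ] ((n C k) · (T k ⊗ (W (n ∸ k) ∘ₚ X ^^ 2)))
  R≈ : ∀ p → (∀ φ → ⟦ p ⟧ φ ≡ 2 * 𝒟 n 2 1 0 φ) → R (2 + n) ≈ p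
  R≈ p ⟦p⟧ = ⟦⟧⇒≈ (R (2 + n)) p (λ φ → trans (⟦R⟧ (suc n) φ) (trans (𝒟-w² n φ) (sym (⟦p⟧ φ))))
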